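{- Let $C\in M(3,\mathbb{Z})$, and let $A,B$ be integer $3\times 3$ matrices such that the identity matrix $E$, $A$ and $B$ form a $\mathbb{Z}$-basis of the additive group $\overline{\Xi}(C)$ of all integer $3\times 3$ matrices commuting with $C$. Let $$Q_{A,B}(x,y,z;m,n)=\bar P_{A,B}(m,n)\,\tilde P_{A,A^{\vee}}(x,y,z),$$ which is a polynomial with integer coefficients. Then $C$ is of Frobenius type if and only if the equation $|Q_{A,B}(x,y,z;m,n)|=1$ has a solution in integers $x,y,z,m,n$.
   Context: $M(3,\mathbb{Z})$ denotes the set of $3\times 3$ matrices with integer entries whose characteristic polynomial is irreducible over $\mathbb{Q}$. For integers $a_1,a_2,a_3$, the Frobenius matrix is $$M_{a_1,a_2,a_3}=\begin{pmatrix} 0 & 1 & 0 \\ 0 & 0 & 1 \\ a_3 & a_2 & a_1 \end{pmatrix}.$$ A matrix $C\in M(3,\mathbb{Z})$ is of Frobenius type if there exist integers $a_1,a_2,a_3$ and $X\in SL(3,\mathbb{Z})$ such that $XCX^{ -1}$ commutes with $M_{a_1,a_2,a_3}$. The group $\overline{\Xi}(C)$ is isomorphic to $\mathbb{Z}^3$. Definition of $\bar P_{A,B}$: since $B\in\overline{\Xi}(C)$, one has $B=\alpha A^2+\beta A+\gamma E$ with rational $\alpha,\beta,\gamma$. Let the characteristic polynomial of $A$ be $\chi(x)=-x^3+a_1x^2-a_2x+a_3$. Then $$\bar P_{A,B}(m,n)=m^3+(2a_1\alpha+3\beta)m^2n+\big((a_2+a_1^2)\alpha^2+4a_1\alpha\beta+3\beta^2\big)mn^2+\big((a_1a_2-a_3)\alpha^3+(a_2+a_1^2)\alpha^2\beta+2a_1\alpha\beta^2+\beta^3\big)n^3.$$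 Definition of $A^\vee$: $A^\vee$ is the adjugate (classical adjoint) of $A$, so that $AA^\vee=\det(A)E$; its $(i,j)$ entry is $(-1)^{i+j}$ times the minor of $A$ obtained by deleting row $j$ and column $i$. Definition of $\tilde P_{A,D}$: for $3\times 3$ matrices $A=(a_{ij})$, $D=(d_{ij})$ put $\langle ij,kl\rangle=\langle ij,kl\rangle_{A,D}=a_{ij}d_{kl}-a_{kl}d_{ij}$, and $$\begin{aligned}\tilde P_{A,D}(x,y,z)={}&\langle 12,13\rangle x^3+\langle 23,21\rangle y^3+\langle 31,32\rangle z^3\\&+\big(\langle 13,11\rangle+\langle 22,13\rangle+\langle 12,23\rangle\big)x^2y+\big(\langle 22,23\rangle+\langle 23,11\rangle+\langle 13,21\rangle\big)xy^2\\&+\big(\langle 12,33\rangle+\langle 11,12\rangle+\langle 32,13\rangle\big)x^2z+\big(\langle 32,33\rangle+\langle 11,32\rangle+\langle 31,12\rangle\big)xz^2\\&+\big(\langle 21,22\rangle+\langle 33,21\rangle+\langle 23,31\rangle\big)y^2z+\big(\langle 31,22\rangle+\langle 33,31\rangle+\langle 21,32\rangle\big)yz^2\\&+\big(\langle 11,22\rangle+\langle 22,33\rangle+\langle 33,11\rangle+3\langle 13,31\rangle\big)xyz.\end{aligned}$$ -}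

module Defs where

open import Algebra.Bundles using (RawRing)
import Algebra.Definitions.RawSemiring as RawSemiringDefs
open import Data.Bool.Base using (if_then_else_)
open import Data.Fin.Base using (Fin; punchIn; toℕ)
open import Data.Fin.Patterns using (0F; 1F; 2F)
import Data.Fin.Properties as Fin
open import Data.Integer.Base as Int using (ℤ; +_)
open import Data.List.Base as List using (List)
open import Data.Nat.Base as ℕ using (ℕ; zero; suc)
import Data.Nat.Properties as ℕ
open import Data.Product.Base using (_×_; _,_; ∃; ∃-syntax; map₁)
open import Data.Rational.Base as Rat using (ℚ)
open import Data.Vec.Base as Vec using (Vec)
open import Data.Vec.Functional using (Vector; []; _∷_)
import Data.Vec.Properties as Vec
open import Level using (0ℓ)
open import Relation.Binary.PropositionalEquality using (_≡_)
open import Relation.Nullary.Decidable using (does)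

-- Polynomials in k variables: finite lists of terms c · X₀^e₀ ⋯ X₍ₖ₋₁₎^e₍ₖ₋₁₎.
-- Exponent vectors may repeat and coefficients may vanish, so equality of
-- polynomials is equality of all collected coefficients.
module PolynomialOver (R : RawRing 0ℓ 0ℓ) where
  open RawRing R
  open RawSemiringDefs rawSemiring using (_^_)

  Poly : ℕ → Set
  Poly k = List (Carrier × Vec ℕ k)

  coeff : ∀ {k} → Poly k → Vec ℕ k → Carrier
  coeff List.[] e = 0#
  coeff ((c , d) List.∷ p) e =
    if does (Vec.≡-dec ℕ._≟_ d e) then c + coeff p e else coeff p e

  eval : ∀ {k} → Poly k → Vec Carrier k → Carrier
  eval List.[] v = 0#
  eval ((c , d) List.∷ p) v =
    c * Vec.foldr _ _*_ 1# (Vec.zipWith _^_ v d) + eval p v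

  monomial : ∀ {k} → Carrier → Vec ℕ k → Poly k
  monomial c e = (c , e) List.∷ List.[]

  const : ∀ {k} → Carrier → Poly k
  const c = monomial c (Vec.replicate _ 0)

  polyRing : ℕ → RawRing 0ℓ 0ℓ
  polyRing k = record
    { Carrier = Poly k
    ; _≈_     = λ p q → ∀ e → coeff p e ≈ coeff q e
    ; _+_     = List._++_
    ; _*_     = λ p q → List.concatMap
                  (λ (c , d) → List.map (λ (c′ , d′) → c * c′ , Vec.zipWith ℕ._+_ d d′) q) p
    ; -_      = List.map (map₁ -_)
    ; 0#      = List.[]
    ; 1#      = const 1#
    }

module MatrixOver (R : RawRing 0ℓ 0ℓ) where
  open RawRing R
  open RawSemiringDefs rawSemiring using (sum; _^_)

  Matrix : ℕ → Set
  Matrix n = Vector (Vector Carrier n) n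

  infix  4 _≋_
  infixl 6 _⊕_
  infixl 7 _⊗_ _·_

  _≋_ : ∀ {n} → Matrix n → Matrix n → Set
  A ≋ B = ∀ i j → A i j ≈ B i j

  O E : ∀ {n} → Matrix n
  O i j = 0#
  E i j = if does (i Fin.≟ j) then 1# else 0#

  _⊕_ _⊗_ : ∀ {n} → Matrix n → Matrix n → Matrix n
  (A ⊕ B) i j = A i j + B i j
  (A ⊗ B) i j = sum (λ k → A i k * B k j)

  _·_ : ∀ {n} → Carrier → Matrix n → Matrix n
  (c · A) i j = c * A i j

  Commutes : ∀ {n} → Matrix n → Matrix n → Set
  Commutes A B = A ⊗ B ≋ B ⊗ A

  combination : ∀ {n k} → Vector Carrier k → Vector (Matrix n) k → Matrix n
  combination c M i j = sum (λ s → c s * M s i j)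

  sign : ℕ → Carrier
  sign k = (- 1#) ^ k

  deleteRowCol : ∀ {n} → Fin (suc n) → Fin (suc n) → Matrix (suc n) → Matrix n
  deleteRowCol r c A i j = A (punchIn r i) (punchIn c j)

  det : ∀ {n} → Matrix n → Carrier
  det {zero}  A = 1#
  det {suc n} A = sum (λ j → sign (toℕ j) * A 0F j * det (deleteRowCol 0F j A))

  adjugate : ∀ {n} → Matrix (suc n) → Matrix (suc n)
  adjugate A i j = sign (toℕ i ℕ.+ toℕ j) * det (deleteRowCol j i A)

  record IsBasis {n k} (G : Matrix n → Set) (M : Vector (Matrix n) k) : Set where
    field
      member      : ∀ s → G (M s)
      spanning    : ∀ A → G A → ∃[ c ] A ≋ combination c M
      independent : ∀ c → combination c M ≋ O → ∀ s → c s ≈ 0#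

  record SL (n : ℕ) : Set where
    field
      matrix   : Matrix n
      inverse  : Matrix n
      inverseˡ : inverse ⊗ matrix ≋ E
      inverseʳ : matrix ⊗ inverse ≋ E
      det≈1    : det matrix ≈ 1#

module ℤP   = PolynomialOver Int.+-*-rawRing
module ℚP   = PolynomialOver Rat.+-*-rawRing
module ℤM   = MatrixOver Int.+-*-rawRing
module ℚM   = MatrixOver Rat.+-*-rawRing
module ℚ[X] = RawRing (ℚP.polyRing 1)
module ℚ[X]M = MatrixOver (ℚP.polyRing 1)

toℚ : ℤ → ℚ
toℚ z = z Rat./ 1

Matℤ Matℚ : Set
Matℤ = ℤM.Matrix 3
Matℚ = ℚM.Matrix 3

toMatℚ : Matℤ → Matℚ
toMatℚ A i j = toℚ (A i j)

-- det (A - X E), so the leading coefficient is -1.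
charPoly : Matℚ → ℚP.Poly 1
charPoly A = ℚ[X]M.det ((λ i j → ℚP.const (A i j)) ⊕ (ℚ[X].- X) · E)
  where
  open ℚ[X]M using (_⊕_; _·_; E)
  X = ℚP.monomial Rat.1ℚ (1 Vec.∷ Vec.[])

M⟨3,ℤ⟩ : Matℤ → Set
M⟨3,ℤ⟩ C = RawSemiringDefs.Irreducible ℚ[X].rawSemiring (charPoly (toMatℚ C))

Ξ̄ : Matℤ → Matℤ → Set
Ξ̄ C A = ℤM.Commutes A C

frobenius : ℤ → ℤ → ℤ → Matℤ
frobenius a₁ a₂ a₃ =
  (+ 0 ∷ + 1 ∷ + 0 ∷ []) ∷
  (+ 0 ∷ + 0 ∷ + 1 ∷ []) ∷
  (a₃  ∷ a₂  ∷ a₁  ∷ []) ∷ []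

FrobeniusType : Matℤ → Set
FrobeniusType C = ∃[ a₁ ] ∃[ a₂ ] ∃[ a₃ ] ∃ λ (X : SL 3) →
  Commutes (SL.matrix X ⊗ C ⊗ SL.inverse X) (frobenius a₁ a₂ a₃)
  where open ℤM

record QuadraticExpression (A B : Matℤ) : Set where
  open ℚM
  private Aℚ = toMatℚ A
  field
    α β γ    : ℚ
    equation : toMatℚ B ≋ α · (Aℚ ⊗ Aℚ) ⊕ β · Aℚ ⊕ γ · E

-- Both forms live in the polynomial ring in the variables x, y, z, m, n,
-- listed in this order.

infix 7 _x^_y^_z^_ _m^_n^_

_x^_y^_z^_ : ℤ → ℕ → ℕ → ℕ → ℤP.Poly 5
c x^ i y^ j z^ k = ℤP.monomial c (i Vec.∷ j Vec.∷ k Vec.∷ 0 Vec.∷ 0 Vec.∷ Vec.[])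

_m^_n^_ : ℚ → ℕ → ℕ → ℚP.Poly 5
c m^ i n^ j = ℚP.monomial c (0 Vec.∷ 0 Vec.∷ 0 Vec.∷ i Vec.∷ j Vec.∷ Vec.[])

P̄ : (A B : Matℤ) → QuadraticExpression A B → ℚP.Poly 5
P̄ A B q =
    Rat.1ℚ m^ 3 n^ 0
  ⊞ (2ℚ * a₁ * α + 3ℚ * β) m^ 2 n^ 1
  ⊞ ((a₂ + a₁ * a₁) * (α * α) + 4ℚ * a₁ * α * β + 3ℚ * (β * β)) m^ 1 n^ 2
  ⊞ ((a₁ * a₂ - a₃) * (α * α * α) + (a₂ + a₁ * a₁) * (α * α) * β
      + 2ℚ * a₁ * α * (β * β) + β * β * β) m^ 0 n^ 3
  where
  open QuadraticExpression q using (α; β)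
  open Rat using (_+_; _*_; _-_; -_)
  open RawRing (ℚP.polyRing 5) using () renaming (_+_ to infixl 6 _⊞_)
  2ℚ = toℚ (+ 2)
  3ℚ = toℚ (+ 3)
  4ℚ = toℚ (+ 4)
  χ = charPoly (toMatℚ A)
  -- χ = -x³ + a₁ x² - a₂ x + a₃
  a₁ = ℚP.coeff χ (2 Vec.∷ Vec.[])
  a₂ = - ℚP.coeff χ (1 Vec.∷ Vec.[])
  a₃ = ℚP.coeff χ (0 Vec.∷ Vec.[])

P̃ : Matℤ → Matℤ → ℤP.Poly 5
P̃ A D =
    ⟨ 12' , 13' ⟩ x^ 3 y^ 0 z^ 0
  ⊞ ⟨ 23' , 21' ⟩ x^ 0 y^ 3 z^ 0
  ⊞ ⟨ 31' , 32' ⟩ x^ 0 y^ 0 z^ 3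
  ⊞ (⟨ 13' , 11' ⟩ + ⟨ 22' , 13' ⟩ + ⟨ 12' , 23' ⟩) x^ 2 y^ 1 z^ 0
  ⊞ (⟨ 22' , 23' ⟩ + ⟨ 23' , 11' ⟩ + ⟨ 13' , 21' ⟩) x^ 1 y^ 2 z^ 0
  ⊞ (⟨ 12' , 33' ⟩ + ⟨ 11' , 12' ⟩ + ⟨ 32' , 13' ⟩) x^ 2 y^ 0 z^ 1
  ⊞ (⟨ 32' , 33' ⟩ + ⟨ 11' , 32' ⟩ + ⟨ 31' , 12' ⟩) x^ 1 y^ 0 z^ 2
  ⊞ (⟨ 21' , 22' ⟩ + ⟨ 33' , 21' ⟩ + ⟨ 23' , 31' ⟩) x^ 0 y^ 2 z^ 1
  ⊞ (⟨ 31' , 22' ⟩ + ⟨ 33' , 31' ⟩ + ⟨ 21' , 32' ⟩) x^ 0 y^ 1 z^ 2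
  ⊞ (⟨ 11' , 22' ⟩ + ⟨ 22' , 33' ⟩ + ⟨ 33' , 11' ⟩ + + 3 * ⟨ 13' , 31' ⟩) x^ 1 y^ 1 z^ 1
  where
  open Int using (_+_; _*_; _-_)
  open RawRing (ℤP.polyRing 5) using () renaming (_+_ to infixl 6 _⊞_)

  ⟨_,_⟩ : Fin 3 × Fin 3 → Fin 3 × Fin 3 → ℤ
  ⟨ (i , j) , (k , l) ⟩ = A i j * D k l - A k l * D i j

  11' = 0F , 0F
  12' = 0F , 1F
  13' = 0F , 2F
  21' = 1F , 0F
  22' = 1F , 1F
  23' = 1F , 2F
  31' = 2F , 0F
  32' = 2F , 1F
  33' = 2F , 2F

Q : (A B : Matℤ) → QuadraticExpression A B → ℚP.Poly 5
Q A B q = P̄ A B q ⊠ List.map (map₁ toℚ) (P̃ A (ℤM.adjugate A))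
  where open RawRing (ℚP.polyRing 5) using () renaming (_*_ to infixl 7 _⊠_)

HasIntegerCoefficients : ∀ {k} → ℚP.Poly k → Set
HasIntegerCoefficients p = ∀ e → ∃[ c ] ℚP.coeff p e ≡ toℚ c

{-# OPTIONS --safe #-}
-- For a row vector v = (x, y, z) and N = mA + nB + kE the polynomial Q_{A,B} takes the
-- value det (v; vN; vN²).  Indeed det (v; vF; vG) is bilinear and alternating in (F, G) and
-- vanishes when F = E, so on the span of E, A, A² it is a 2×2 determinant in coordinates
-- times det (v; vA; vA²); the former gives P̄ (by the characteristic equation of A) and the
-- latter is P̃, because A^∨ = A² - tr(A) A + σ₂(A) E.  Expanding N in m and n also writes
-- each coefficient of Q as an integer combination of brackets of integer matrices.
--
-- C is of Frobenius type iff some N commuting with C satisfies XN = MX with M a Frobenius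
-- matrix and X ∈ SL(3, ℤ).  Such an X has rows v, vN, vN², so this means det (v; vN; vN²) = 1
-- for some v; a value -1 is repaired by replacing X with -X.
--
-- Write A² = c₀E + c₁A + c₂B.  If c₂ ≠ 0 then B is a quadratic expression in A.  If c₂ = 0,
-- then S = A - (tr A - c₁) E has vanishing adjugate, hence rank one, and it commutes with C;
-- so C has a rational eigenvalue and its characteristic polynomial is reducible.
module Submission where

open import Defs
open import Data.Product.Base using (_×_; ∃-syntax)
open import Data.Rational.Base using (∣_∣; 1ℚ)
open import Data.Vec.Base as Vec using (Vec)
open import Data.Vec.Functional using ([]; _∷_)
open import Function.Bundles using (_⇔_)
open import Relation.Binary.PropositionalEquality using (_≡_)

open import Algebra.Bundles using (CommutativeRing; Monoid; RawRing)
import Algebra.Definitions.RawMagma as RawMagmaDefs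
import Algebra.Definitions.RawSemiring as RawSemiringDefs
import Algebra.Properties.CommutativeSemigroup as CommutativeSemigroupProperties
import Algebra.Properties.Group as GroupProperties
import Algebra.Properties.Ring as RingProperties
import Algebra.Properties.Semiring.Exp as Exp
import Algebra.Properties.Semiring.Mult.TCOptimised as Mult
import Algebra.Properties.Semiring.Sum as Sum
import Algebra.Solver.Ring as Solver
open import Algebra.Solver.Ring.AlmostCommutativeRing
  using (fromCommutativeRing; _-Raw-AlmostCommutative⟶_)
open import Data.Bool.Base using (if_then_else_)
open import Data.Empty using (⊥; ⊥-elim)
open import Data.Fin using (#_)
open import Data.Fin.Base as Fin using (Fin; combine; punchIn; _↑ˡ_; _↑ʳ_)
open import Data.Fin.Patterns
import Data.Fin.Properties as Fin
open import Data.Integer.Base as ℤ using (ℤ; +_; -[1+_]; _⊖_)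
import Data.Integer.Properties as ℤ
open import Data.List.Base as List using (List)
import Data.List.Properties as List
open import Data.List.Relation.Unary.All as All using (All)
import Data.List.Relation.Unary.All.Properties as All
open import Data.Maybe.Base using (Maybe; just; nothing)
open import Data.Nat.Base as ℕ using (ℕ; zero; suc)
import Data.Nat.Properties as ℕ
open import Data.Product.Base using (_,_; proj₁; proj₂; map₁)
import Data.Rational.Base as ℚ
open import Data.Rational.Base using (ℚ)
import Data.Rational.Properties as ℚ
import Data.Rational.Unnormalised.Base as ℚᵘ
import Data.Rational.Unnormalised.Properties as ℚᵘ
open import Data.Sum.Base using (_⊎_; inj₁; inj₂; [_,_]′)
open import Data.Vec.Functional using (Vector)
import Data.Vec.Properties as Vec
open import Function.Bundles using (mk⇔)
open import Level using (0ℓ)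
open import Relation.Binary.PropositionalEquality as ≡ using (_≢_)
open import Relation.Nullary.Decidable using (Dec; yes; no; does)
open import Relation.Nullary.Negation using (¬_; contradiction)

-- Polynomial identities with integer coefficients in a commutative ring.

module IntegerRingSolver (R : CommutativeRing 0ℓ 0ℓ) where
  open CommutativeRing R
  open RingProperties ring
  open Mult semiring using (1+×; ×-homo-+; ×1-homo-*) renaming (_×_ to infixl 8 _×ₙ_)
  open import Relation.Binary.Reasoning.Setoid setoid

  ι : ℤ → Carrier
  ι (+ n)    = n ×ₙ 1#
  ι -[1+ n ] = - (suc n ×ₙ 1#)

  ι-neg : ∀ i → ι (ℤ.- i) ≈ - ι i
  ι-neg (+ zero)  = sym -0#≈0#
  ι-neg (+ suc n) = refl
  ι-neg -[1+ n ]  = sym (-‿involutive _)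

  ι-⊖ : ∀ m n → ι (m ⊖ n) ≈ m ×ₙ 1# - n ×ₙ 1#
  ι-⊖ m zero = sym (trans (+-congˡ -0#≈0#) (+-identityʳ _))
  ι-⊖ zero (suc n) = sym (+-identityˡ _)
  ι-⊖ (suc m) (suc n) = begin
    ι (suc m ⊖ suc n)                    ≡⟨ ≡.cong ι (ℤ.[1+m]⊖[1+n]≡m⊖n m n) ⟩
    ι (m ⊖ n)                            ≈⟨ ι-⊖ m n ⟩
    m ×ₙ 1# - n ×ₙ 1#                      ≈⟨ +-congʳ (+-identityʳ _) ⟨
    m ×ₙ 1# + 0# - n ×ₙ 1#                 ≈⟨ +-congʳ (+-congˡ (-‿inverseʳ 1#)) ⟨
    m ×ₙ 1# + (1# - 1#) - n ×ₙ 1#          ≈⟨ +-congʳ (+-assoc _ _ _) ⟨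
    m ×ₙ 1# + 1# - 1# - n ×ₙ 1#            ≈⟨ +-assoc _ _ _ ⟩
    m ×ₙ 1# + 1# + (- 1# - n ×ₙ 1#)        ≈⟨ +-cong (+-comm _ _) (-‿+-comm _ _) ⟩
    1# + m ×ₙ 1# - (1# + n ×ₙ 1#)          ≈⟨ +-cong (1+× m 1#) (-‿cong (1+× n 1#)) ⟨
    suc m ×ₙ 1# - suc n ×ₙ 1#              ∎

  ι-+ : ∀ i j → ι (i ℤ.+ j) ≈ ι i + ι j
  ι-+ (+ m) (+ n) = ×-homo-+ 1# m n
  ι-+ (+ m) -[1+ n ] = ι-⊖ m (suc n)
  ι-+ -[1+ m ] (+ n) = trans (ι-⊖ n (suc m)) (+-comm _ _)
  ι-+ -[1+ m ] -[1+ n ] = begin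
    - (suc (suc (m ℕ.+ n)) ×ₙ 1#)      ≈⟨ -‿cong (1+× (suc (m ℕ.+ n)) 1#) ⟩
    - (1# + (suc m ℕ.+ n) ×ₙ 1#)       ≈⟨ -‿cong (+-congˡ (×-homo-+ 1# (suc m) n)) ⟩
    - (1# + (suc m ×ₙ 1# + n ×ₙ 1#))    ≈⟨ -‿cong (+-assoc _ _ _) ⟨
    - (1# + suc m ×ₙ 1# + n ×ₙ 1#)      ≈⟨ -‿cong (+-congʳ (+-comm _ _)) ⟩
    - (suc m ×ₙ 1# + 1# + n ×ₙ 1#)      ≈⟨ -‿cong (+-assoc _ _ _) ⟩
    - (suc m ×ₙ 1# + (1# + n ×ₙ 1#))    ≈⟨ -‿cong (+-congˡ (1+× n 1#)) ⟨
    - (suc m ×ₙ 1# + suc n ×ₙ 1#)       ≈⟨ -‿+-comm _ _ ⟨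
    - (suc m ×ₙ 1#) - suc n ×ₙ 1#       ∎

  ι-*⁺ : ∀ m n → ι (+ m ℤ.* + n) ≈ ι (+ m) * ι (+ n)
  ι-*⁺ m n = trans (reflexive (≡.cong ι (≡.sym (ℤ.pos-* m n)))) (×1-homo-* m n)

  ι-*ʳ : ∀ m j → ι (+ m ℤ.* j) ≈ ι (+ m) * ι j
  ι-*ʳ m (+ n)    = ι-*⁺ m n
  ι-*ʳ m -[1+ n ] = begin
    ι (+ m ℤ.* -[1+ n ])          ≡⟨ ≡.cong ι (ℤ.neg-distribʳ-* (+ m) (+ suc n)) ⟨
    ι (ℤ.- (+ m ℤ.* + suc n))     ≈⟨ ι-neg (+ m ℤ.* + suc n) ⟩
    - ι (+ m ℤ.* + suc n)         ≈⟨ -‿cong (ι-*⁺ m (suc n)) ⟩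
    - (ι (+ m) * ι (+ suc n))     ≈⟨ -‿distribʳ-* _ _ ⟩
    ι (+ m) * ι -[1+ n ]          ∎

  ι-* : ∀ i j → ι (i ℤ.* j) ≈ ι i * ι j
  ι-* (+ m)    j = ι-*ʳ m j
  ι-* -[1+ m ] j = begin
    ι (-[1+ m ] ℤ.* j)            ≡⟨ ≡.cong ι (ℤ.neg-distribˡ-* (+ suc m) j) ⟨
    ι (ℤ.- (+ suc m ℤ.* j))       ≈⟨ ι-neg (+ suc m ℤ.* j) ⟩
    - ι (+ suc m ℤ.* j)           ≈⟨ -‿cong (ι-*ʳ (suc m) j) ⟩
    - (ι (+ suc m) * ι j)         ≈⟨ -‿distribˡ-* _ _ ⟩
    ι -[1+ m ] * ι j              ∎

  morphism : ℤ.+-*-rawRing -Raw-AlmostCommutative⟶ fromCommutativeRing R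
  morphism = record
    { ⟦_⟧ = ι ; +-homo = ι-+ ; *-homo = ι-* ; -‿homo = ι-neg
    ; 0-homo = refl ; 1-homo = refl }

  -- Distinct integers may have the same image in the ring, so only equality of the integers
  -- themselves is reported.
  ι-≟ : ∀ i j → Maybe (ι i ≈ ι j)
  ι-≟ i j with i ℤ.≟ j
  ... | yes ≡.refl = just refl
  ... | no _ = nothing

  open Solver ℤ.+-*-rawRing (fromCommutativeRing R) morphism ι-≟ public
    using (Polynomial; var; con; _:+_; _:*_; :-_; prove)

  -- Definitions made over an arbitrary raw ring, such as det, are instantiated at polynomial
  -- expressions to obtain the solver's input; it evaluates to their instance at R.
  syntaxRing : ℕ → RawRing 0ℓ 0ℓ
  syntaxRing n = record
    { Carrier = Polynomial n ; _≈_ = _≡_ ; _+_ = _:+_ ; _*_ = _:*_ ; -_ = :-_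
    ; 0# = con (+ 0) ; 1# = con (+ 1) }

-- Bracket forms and the monomials of the two factors of Q.

Cell : Set
Cell = Fin 3 × Fin 3

infix 8 ⟨_,_⟩
infixl 6 _⊞_

data Form : Set where
  ⟨_,_⟩ : Cell → Cell → Form
  _⊞_   : Form → Form → Form

-- These are the coefficients of P̃.  That of xyz is kept in the form valid for all pairs of matrices;
-- when D = A^∨ the last three brackets coincide, which gives 3⟨13,31⟩.
form : Fin 10 → Form
form = λ where
    0F → ⟨ 12' , 13' ⟩
    1F → ⟨ 23' , 21' ⟩
    2F → ⟨ 31' , 32' ⟩
    3F → ⟨ 13' , 11' ⟩ ⊞ ⟨ 22' , 13' ⟩ ⊞ ⟨ 12' , 23' ⟩
    4F → ⟨ 22' , 23' ⟩ ⊞ ⟨ 23' , 11' ⟩ ⊞ ⟨ 13' , 21' ⟩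
    5F → ⟨ 12' , 33' ⟩ ⊞ ⟨ 11' , 12' ⟩ ⊞ ⟨ 32' , 13' ⟩
    6F → ⟨ 32' , 33' ⟩ ⊞ ⟨ 11' , 32' ⟩ ⊞ ⟨ 31' , 12' ⟩
    7F → ⟨ 21' , 22' ⟩ ⊞ ⟨ 33' , 21' ⟩ ⊞ ⟨ 23' , 31' ⟩
    8F → ⟨ 31' , 22' ⟩ ⊞ ⟨ 33' , 31' ⟩ ⊞ ⟨ 21' , 32' ⟩
    9F → ⟨ 11' , 22' ⟩ ⊞ ⟨ 22' , 33' ⟩ ⊞ ⟨ 33' , 11' ⟩ ⊞ (⟨ 13' , 31' ⟩ ⊞ ⟨ 21' , 12' ⟩ ⊞ ⟨ 32' , 23' ⟩)
  where
  11' 12' 13' 21' 22' 23' 31' 32' 33' : Cell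
  11' = 0F , 0F
  12' = 0F , 1F
  13' = 0F , 2F
  21' = 1F , 0F
  22' = 1F , 1F
  23' = 1F , 2F
  31' = 2F , 0F
  32' = 2F , 1F
  33' = 2F , 2F

exponents : Fin 10 → Vec ℕ 5
exponents = λ where
    0F → xyz 3 0 0
    1F → xyz 0 3 0
    2F → xyz 0 0 3
    3F → xyz 2 1 0
    4F → xyz 1 2 0
    5F → xyz 2 0 1
    6F → xyz 1 0 2
    7F → xyz 0 2 1
    8F → xyz 0 1 2
    9F → xyz 1 1 1
  where
  xyz : ℕ → ℕ → ℕ → Vec ℕ 5
  xyz i j k = i Vec.∷ j Vec.∷ k Vec.∷ 0 Vec.∷ 0 Vec.∷ Vec.[]

normExponents : Fin 4 → Vec ℕ 5
normExponents s = 0 Vec.∷ 0 Vec.∷ 0 Vec.∷ 3 ℕ.∸ Fin.toℕ s Vec.∷ Fin.toℕ s Vec.∷ Vec.[]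

-- Definitions for 3×3 matrices and cubic forms over a raw ring.

module CubicOver (R : RawRing 0ℓ 0ℓ) where
  open RawRing R
  open RawSemiringDefs rawSemiring using (sum)
  open MatrixOver R public
  open PolynomialOver R public

  infixl 7 _⊛_

  _⊛_ : Vector Carrier 3 → Matrix 3 → Vector Carrier 3
  (v ⊛ A) j = sum (λ i → v i * A i j)

  -- `σ₂` is the sum of the principal 2×2 minors, the a₂ of the characteristic polynomial.
  trace σ₂ : Matrix 3 → Carrier
  trace A = A 0F 0F + A 1F 1F + A 2F 2F
  σ₂ A    = trace (adjugate A)

  shift : Carrier → Matrix 3 → Matrix 3
  shift r A = A ⊕ (- r) · E

  quadratic : Carrier → Carrier → Carrier → Matrix 3 → Matrix 3
  quadratic α β γ A = α · (A ⊗ A) ⊕ β · A ⊕ γ · E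

  companion : Carrier → Carrier → Carrier → Matrix 3
  companion a₁ a₂ a₃ =
    (0# ∷ 1# ∷ 0# ∷ []) ∷
    (0# ∷ 0# ∷ 1# ∷ []) ∷
    (a₃ ∷ a₂ ∷ a₁ ∷ []) ∷ []

  krylov : Vector Carrier 3 → Matrix 3 → Matrix 3
  krylov v A = v ∷ v ⊛ A ∷ v ⊛ A ⊛ A ∷ []

  -- This repeats `charPoly` over an arbitrary raw ring so that it can also be formed over solver
  -- expressions; over ℚ the two agree by computation.
  χ : Matrix 3 → Poly 1
  χ A = M.det ((λ i j → const (A i j)) M.⊕ (RawRing.-_ (polyRing 1) (monomial 1# (1 Vec.∷ Vec.[]))) M.· M.E)
    where module M = MatrixOver (polyRing 1)

  ⟦_⟧ : Form → Matrix 3 → Matrix 3 → Carrier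
  ⟦ ⟨ (i , j) , (k , l) ⟩ ⟧ F G = F i j * G k l + - (F k l * G i j)
  ⟦ f ⊞ g ⟧                 F G = ⟦ f ⟧ F G + ⟦ g ⟧ F G

  ternary : Matrix 3 → Matrix 3 → Poly 5
  ternary F G = List.tabulate λ s → ⟦ form s ⟧ F G , exponents s

  -- The coefficients of P̄ at m³, m²n, mn² and n³.
  normCoefficient : Fin 4 → (a₁ a₂ a₃ α β : Carrier) → Carrier
  normCoefficient = λ where
      0F a₁ a₂ a₃ α β → 1#
      1F a₁ a₂ a₃ α β → 2# * a₁ * α + 3# * β
      2F a₁ a₂ a₃ α β → (a₂ + a₁ * a₁) * (α * α) + 4# * a₁ * α * β + 3# * (β * β)
      3F a₁ a₂ a₃ α β → (a₁ * a₂ + - a₃) * (α * α * α) + (a₂ + a₁ * a₁) * (α * α) * β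
                          + 2# * a₁ * α * (β * β) + β * β * β
    where
    2# = 1# + 1#
    3# = 2# + 1#
    4# = 3# + 1#

  binary : (a₁ a₂ a₃ α β : Carrier) → Poly 5
  binary a₁ a₂ a₃ α β = List.tabulate λ s →
    normCoefficient s a₁ a₂ a₃ α β , normExponents s

  -- The coefficients of m³, m²n, mn², n³ in ⟦ f ⟧ N (N ⊗ N) for N = mA + nB
  -- with AB = BA.
  mixed : Fin 4 → Form → Matrix 3 → Matrix 3 → Carrier
  mixed = λ where
    0F f A B → ⟦ f ⟧ A (A ⊗ A)
    1F f A B → ⟦ f ⟧ A (A ⊗ B) + ⟦ f ⟧ A (A ⊗ B) + ⟦ f ⟧ B (A ⊗ A)
    2F f A B → ⟦ f ⟧ A (B ⊗ B) + ⟦ f ⟧ B (A ⊗ B) + ⟦ f ⟧ B (A ⊗ B)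
    3F f A B → ⟦ f ⟧ B (B ⊗ B)

  cross : (u w : Vector Carrier 3) → Vector Carrier 3
  cross u w =
    u 1F * w 2F + - (u 2F * w 1F) ∷
    u 2F * w 0F + - (u 0F * w 2F) ∷
    u 0F * w 1F + - (u 1F * w 0F) ∷ []

-- In cyclic order, cofactors of a 3×3 matrix are cross products without signs.
next : Fin 3 → Fin 3
next = λ where
  0F → 1F
  1F → 2F
  2F → 0F

byEntries : {P : Fin 3 → Fin 3 → Set} →
            P 0F 0F → P 0F 1F → P 0F 2F →
            P 1F 0F → P 1F 1F → P 1F 2F →
            P 2F 0F → P 2F 1F → P 2F 2F → ∀ i j → P i j
byEntries a b c d e f g h k = λ where
  0F 0F → a ; 0F 1F → b ; 0F 2F → c
  1F 0F → d ; 1F 1F → e ; 1F 2F → f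
  2F 0F → g ; 2F 1F → h ; 2F 2F → k

-- Identities for 3×3 matrices over a commutative ring.

module CubicTheory (R : CommutativeRing 0ℓ 0ℓ) where
  open CommutativeRing R hiding (zero)
  open IntegerRingSolver R public
  open CubicOver rawRing public
  open Sum semiring using (sum; sum-cong-≋; ∑-comm; ∑-distrib-+; *-distribˡ-sum; *-distribʳ-sum; sum-replicate-zero)
  open CommutativeSemigroupProperties *-commutativeSemigroup using (x∙yz≈y∙xz)
  open import Relation.Binary.Reasoning.Setoid setoid
  module S {n : ℕ} = CubicOver (syntaxRing n)

  entries : Matrix 3 → Vec Carrier 9
  entries A = Vec.concat (Vec.tabulate λ i → Vec.tabulate (A i))

  -- A generic matrix whose entries are the variables numbered k to k + 8, in the row order of
  -- `entries`; `vec` and `at` address the rest of the environment in the same way.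
  mat : ∀ k {l} → S.Matrix {k ℕ.+ (9 ℕ.+ l)} 3
  mat k i j = var (k ↑ʳ (combine i j ↑ˡ _))

  vec : ∀ k {l} → Fin 3 → Polynomial (k ℕ.+ (3 ℕ.+ l))
  vec k i = var (k ↑ʳ (i ↑ˡ _))

  at : ∀ k {l} → Polynomial (k ℕ.+ suc l)
  at k = var (k ↑ʳ 0F)

  column : Matrix 3 → Fin 3 → Vec Carrier 3
  column A j = Vec.tabulate λ i → A i j

  -- This is adj S = S² - tr(S) S + σ₂(S) E for S = A - ρE, expanded in powers of A.
  adjugate-shift : ∀ ρ A → adjugate (shift ρ A) ≋ quadratic 1# (ρ + - trace A) (ρ * ρ + - (ρ * trace A) + σ₂ A) A
  adjugate-shift ρ A = byEntries
    (prove e (l 0F 0F) (r 0F 0F) refl) (prove e (l 0F 1F) (r 0F 1F) refl) (prove e (l 0F 2F) (r 0F 2F) refl)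
    (prove e (l 1F 0F) (r 1F 0F) refl) (prove e (l 1F 1F) (r 1F 1F) refl) (prove e (l 1F 2F) (r 1F 2F) refl)
    (prove e (l 2F 0F) (r 2F 0F) refl) (prove e (l 2F 1F) (r 2F 1F) refl) (prove e (l 2F 2F) (r 2F 2F) refl)
    where
    e = entries A Vec.++ ρ Vec.∷ Vec.[]
    Â = mat 0
    ρ̂ = at 9
    l = S.adjugate (S.shift ρ̂ Â)
    r = S.quadratic (con (+ 1)) (ρ̂ :+ :- S.trace Â) (ρ̂ :* ρ̂ :+ :- (ρ̂ :* S.trace Â) :+ S.σ₂ Â) Â

  ⊗-adjugate : (A : Matrix 3) → A ⊗ adjugate A ≋ det A · E
  ⊗-adjugate A = byEntries
    (prove e (l 0F 0F) (r 0F 0F) refl) (prove e (l 0F 1F) (r 0F 1F) refl) (prove e (l 0F 2F) (r 0F 2F) refl)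
    (prove e (l 1F 0F) (r 1F 0F) refl) (prove e (l 1F 1F) (r 1F 1F) refl) (prove e (l 1F 2F) (r 1F 2F) refl)
    (prove e (l 2F 0F) (r 2F 0F) refl) (prove e (l 2F 1F) (r 2F 1F) refl) (prove e (l 2F 2F) (r 2F 2F) refl)
    where
    e = entries A
    l = mat 0 S.⊗ S.adjugate (mat 0)
    r = S.det (mat 0) S.· S.E {9} {3}

  adjugate-⊗ : (A : Matrix 3) → adjugate A ⊗ A ≋ det A · E
  adjugate-⊗ A = byEntries
    (prove e (l 0F 0F) (r 0F 0F) refl) (prove e (l 0F 1F) (r 0F 1F) refl) (prove e (l 0F 2F) (r 0F 2F) refl)
    (prove e (l 1F 0F) (r 1F 0F) refl) (prove e (l 1F 1F) (r 1F 1F) refl) (prove e (l 1F 2F) (r 1F 2F) refl)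
    (prove e (l 2F 0F) (r 2F 0F) refl) (prove e (l 2F 1F) (r 2F 1F) refl) (prove e (l 2F 2F) (r 2F 2F) refl)
    where
    e = entries A
    l = S.adjugate (mat 0) S.⊗ mat 0
    r = S.det (mat 0) S.· S.E {9} {3}

  -- The Cayley-Hamilton identity A³ = tr(A) A² - σ₂(A) A + det(A) E reduces the cubic term.
  ⊗-quadratic : ∀ α β γ A →
    A ⊗ quadratic α β γ A ≋ quadratic (α * trace A + β) (γ + - (α * σ₂ A)) (α * det A) A
  ⊗-quadratic α β γ A = byEntries
    (prove e (l 0F 0F) (r 0F 0F) refl) (prove e (l 0F 1F) (r 0F 1F) refl) (prove e (l 0F 2F) (r 0F 2F) refl)
    (prove e (l 1F 0F) (r 1F 0F) refl) (prove e (l 1F 1F) (r 1F 1F) refl) (prove e (l 1F 2F) (r 1F 2F) refl)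
    (prove e (l 2F 0F) (r 2F 0F) refl) (prove e (l 2F 1F) (r 2F 1F) refl) (prove e (l 2F 2F) (r 2F 2F) refl)
    where
    e = entries A Vec.++ α Vec.∷ β Vec.∷ γ Vec.∷ Vec.[]
    Â = mat 0
    α̂ = at 9
    β̂ = at 10
    γ̂ = at 11
    l = Â S.⊗ S.quadratic α̂ β̂ γ̂ Â
    r = S.quadratic (α̂ :* S.trace Â :+ β̂) (γ̂ :+ :- (α̂ :* S.σ₂ Â)) (α̂ :* S.det Â) Â

  -- Since vF and vG are linear in v, the determinant is a ternary cubic in v, and its coefficients
  -- are sums of brackets of entries of F and G.
  ternary-det : ∀ F G x y z m n →
    let v = x ∷ y ∷ z ∷ [] in
    eval (ternary F G) (x Vec.∷ y Vec.∷ z Vec.∷ m Vec.∷ n Vec.∷ Vec.[]) ≈ det (v ∷ v ⊛ F ∷ v ⊛ G ∷ [])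
  ternary-det F G x y z m n = prove e
    (S.eval (S.ternary F̂ Ĝ) (x̂ Vec.∷ ŷ Vec.∷ ẑ Vec.∷ at 21 Vec.∷ at 22 Vec.∷ Vec.[]))
    (S.det (v̂ ∷ v̂ S.⊛ F̂ ∷ v̂ S.⊛ Ĝ ∷ []))
    refl
    where
    e = (entries F Vec.++ entries G) Vec.++ x Vec.∷ y Vec.∷ z Vec.∷ m Vec.∷ n Vec.∷ Vec.[]
    F̂ = mat 0
    Ĝ = mat 9
    x̂ = at 18
    ŷ = at 19
    ẑ = at 20
    v̂ = x̂ ∷ ŷ ∷ ẑ ∷ []

  ⊗-cong : ∀ {n} {A A′ B B′ : Matrix n} → A ≋ A′ → B ≋ B′ → A ⊗ B ≋ A′ ⊗ B′
  ⊗-cong A≋A′ B≋B′ i j = sum-cong-≋ λ k → *-cong (A≋A′ i k) (B≋B′ k j)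

  det-cong : ∀ {n} {A B : Matrix n} → A ≋ B → det A ≈ det B
  det-cong {zero}  A≋B = refl
  det-cong {suc n} A≋B = sum-cong-≋ λ j →
    *-cong (*-congˡ {sign (Fin.toℕ j)} (A≋B 0F j)) (det-cong λ i k → A≋B (Fin.suc i) (punchIn j k))

  ⊛-assoc : ∀ v A B j → (v ⊛ A ⊛ B) j ≈ (v ⊛ (A ⊗ B)) j
  ⊛-assoc v A B j = begin
    sum (λ k → sum (λ i → v i * A i k) * B k j)    ≈⟨ sum-cong-≋ (λ k → *-distribʳ-sum (B k j) (λ i → v i * A i k)) ⟩
    sum (λ k → sum (λ i → v i * A i k * B k j))    ≈⟨ ∑-comm (λ k i → v i * A i k * B k j) ⟩
    sum (λ i → sum (λ k → v i * A i k * B k j))    ≈⟨ sum-cong-≋ (λ i → sum-cong-≋ λ k → *-assoc (v i) (A i k) (B k j)) ⟩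
    sum (λ i → sum (λ k → v i * (A i k * B k j)))  ≈⟨ sum-cong-≋ (λ i → *-distribˡ-sum (v i) (λ k → A i k * B k j)) ⟨
    sum (λ i → v i * sum (λ k → A i k * B k j))    ∎

  ⊗-assoc : (A B C : Matrix 3) → A ⊗ B ⊗ C ≋ A ⊗ (B ⊗ C)
  ⊗-assoc A B C i = ⊛-assoc (A i) B C

  ⊗-identityˡ : (A : Matrix 3) → E ⊗ A ≋ A
  ⊗-identityˡ A = λ where
      0F j → prove (column A j) (l 0F) (vec 0 0F) refl
      1F j → prove (column A j) (l 1F) (vec 0 1F) refl
      2F j → prove (column A j) (l 2F) (vec 0 2F) refl
    where
    l : Fin 3 → Polynomial 3
    l i = (S.E S.⊗ (λ k _ → vec 0 k)) i 0F

  ⊗-identityʳ : (A : Matrix 3) → A ⊗ E ≋ A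
  ⊗-identityʳ A = λ where
      i 0F → prove (Vec.tabulate (A i)) (l 0F) (vec 0 0F) refl
      i 1F → prove (Vec.tabulate (A i)) (l 1F) (vec 0 1F) refl
      i 2F → prove (Vec.tabulate (A i)) (l 2F) (vec 0 2F) refl
    where
    l : Fin 3 → Polynomial 3
    l j = ((λ _ k → vec 0 k) S.⊗ S.E) 0F j

  ⊗-distribʳ-⊕ : ∀ {n} (A B C : Matrix n) → (A ⊕ B) ⊗ C ≋ A ⊗ C ⊕ B ⊗ C
  ⊗-distribʳ-⊕ A B C i j = trans
    (sum-cong-≋ λ k → distribʳ (C k j) (A i k) (B i k)) (∑-distrib-+ (λ k → A i k * C k j) (λ k → B i k * C k j))

  ⊗-distribˡ-⊕ : ∀ {n} (A B C : Matrix n) → A ⊗ (B ⊕ C) ≋ A ⊗ B ⊕ A ⊗ C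
  ⊗-distribˡ-⊕ A B C i j = trans
    (sum-cong-≋ λ k → distribˡ (A i k) (B k j) (C k j)) (∑-distrib-+ (λ k → A i k * B k j) (λ k → A i k * C k j))

  ·-⊗ : ∀ {n} r (A B : Matrix n) → r · A ⊗ B ≋ r · (A ⊗ B)
  ·-⊗ r A B i j = trans
    (sum-cong-≋ λ k → *-assoc r (A i k) (B k j)) (sym (*-distribˡ-sum r (λ k → A i k * B k j)))

  ⊗-· : ∀ {n} r (A B : Matrix n) → A ⊗ (r · B) ≋ r · (A ⊗ B)
  ⊗-· r A B i j = trans
    (sum-cong-≋ λ k → x∙yz≈y∙xz (A i k) r (B k j)) (sym (*-distribˡ-sum r (λ k → A i k * B k j)))

  commutes-E : (C : Matrix 3) → Commutes E C
  commutes-E C i j = trans (⊗-identityˡ C i j) (sym (⊗-identityʳ C i j))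

  commutes-· : ∀ {n} r {A C : Matrix n} → Commutes A C → Commutes (r · A) C
  commutes-· r {A = A} {C} AC i j = trans (·-⊗ r A C i j) (trans (*-congˡ (AC i j)) (sym (⊗-· r C A i j)))

  commutes-⊕ : ∀ {n} {A B C : Matrix n} → Commutes A C → Commutes B C → Commutes (A ⊕ B) C
  commutes-⊕ {A = A} {B} {C} AC BC i j =
    trans (⊗-distribʳ-⊕ A B C i j) (trans (+-cong (AC i j) (BC i j)) (sym (⊗-distribˡ-⊕ C A B i j)))

  commutes-⊗ : ∀ {A B C : Matrix 3} → Commutes A C → Commutes B C → Commutes (A ⊗ B) C
  commutes-⊗ {A} {B} {C} AC BC i j = begin
    (A ⊗ B ⊗ C) i j      ≈⟨ ⊗-assoc A B C i j ⟩
    (A ⊗ (B ⊗ C)) i j    ≈⟨ ⊗-cong {A = A} {A} (λ _ _ → refl) BC i j ⟩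
    (A ⊗ (C ⊗ B)) i j    ≈⟨ ⊗-assoc A C B i j ⟨
    (A ⊗ C ⊗ B) i j      ≈⟨ ⊗-cong {B = B} {B} AC (λ _ _ → refl) i j ⟩
    (C ⊗ A ⊗ B) i j      ≈⟨ ⊗-assoc C A B i j ⟩
    (C ⊗ (A ⊗ B)) i j    ∎

  matrixMonoid : Monoid 0ℓ 0ℓ
  matrixMonoid = record
    { Carrier = Matrix 3
    ; _≈_ = _≋_
    ; _∙_ = _⊗_
    ; ε = E
    ; isMonoid = record
      { isSemigroup = record
        { isMagma = record
          { isEquivalence = record
            { refl  = λ i j → refl
            ; sym   = λ A≋B i j → sym (A≋B i j)
            ; trans = λ A≋B B≋C i j → trans (A≋B i j) (B≋C i j)
            }
          ; ∙-cong = ⊗-cong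
          }
        ; assoc = ⊗-assoc
        }
      ; identity = ⊗-identityˡ , ⊗-identityʳ
      }
    }

  det-· : ∀ r (A : Matrix 3) → det (r · A) ≈ r * r * r * det A
  det-· r A = prove (entries A Vec.++ r Vec.∷ Vec.[])
    (S.det (at 9 S.· mat 0)) (at 9 :* at 9 :* at 9 :* S.det (mat 0)) refl

  -- The first two rows agree by construction; the third is the Cayley-Hamilton identity applied to
  -- v.
  krylov-⊗ : ∀ v A → krylov v A ⊗ A ≋ companion (trace A) (- σ₂ A) (det A) ⊗ krylov v A
  krylov-⊗ v A = byEntries
    (prove e (l 0F 0F) (r 0F 0F) refl) (prove e (l 0F 1F) (r 0F 1F) refl) (prove e (l 0F 2F) (r 0F 2F) refl)
    (prove e (l 1F 0F) (r 1F 0F) refl) (prove e (l 1F 1F) (r 1F 1F) refl) (prove e (l 1F 2F) (r 1F 2F) refl)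
    (prove e (l 2F 0F) (r 2F 0F) refl) (prove e (l 2F 1F) (r 2F 1F) refl) (prove e (l 2F 2F) (r 2F 2F) refl)
    where
    e = entries A Vec.++ Vec.tabulate v
    Â = mat 0
    l = S.krylov (vec 9) Â S.⊗ Â
    r = S.companion (S.trace Â) (:- S.σ₂ Â) (S.det Â) S.⊗ S.krylov (vec 9) Â

  companion-⊗ : ∀ a₁ a₂ a₃ X → companion a₁ a₂ a₃ ⊗ X ≋
    X 1F ∷ X 2F ∷ (λ j → a₃ * X 0F j + a₂ * X 1F j + a₁ * X 2F j) ∷ []
  companion-⊗ a₁ a₂ a₃ X = λ where
      0F j → prove (e j) (l 0F) (vec 0 1F) refl
      1F j → prove (e j) (l 1F) (vec 0 2F) refl
      2F j → prove (e j) (l 2F) (at 5 :* vec 0 0F :+ at 4 :* vec 0 1F :+ at 3 :* vec 0 2F) refl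
    where
    e = λ j → column X j Vec.++ a₁ Vec.∷ a₂ Vec.∷ a₃ Vec.∷ Vec.[]
    l : Fin 3 → Polynomial 6
    l i = (S.companion (at 3) (at 4) (at 5) S.⊗ (λ k _ → vec 0 k)) i 0F

  -- The first two rows of a companion matrix shift the rows of X upwards, so the hypothesis makes
  -- each later row of X the previous one times N.
  companion-rows : ∀ {a₁ a₂ a₃ X N} → X ⊗ N ≋ companion a₁ a₂ a₃ ⊗ X → X ≋ krylov (X 0F) N
  companion-rows {a₁} {a₂} {a₃} {X} {N} XN = λ where
      0F j → refl
      1F j → row₁ j
      2F j → trans (sym (trans (XN 1F j) (companion-⊗ a₁ a₂ a₃ X 1F j)))
                   (sum-cong-≋ λ k → *-congʳ {N k j} (row₁ k))
    where
    row₁ : ∀ j → X 1F j ≈ (X 0F ⊛ N) j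
    row₁ j = sym (trans (XN 0F j) (companion-⊗ a₁ a₂ a₃ X 0F j))

  krylov-cong : ∀ {v w} N → (∀ j → v j ≈ w j) → krylov v N ≋ krylov w N
  krylov-cong {v} {w} N v≈w = λ where
      0F j → v≈w j
      1F j → step v≈w j
      2F j → step (step v≈w) j
    where
    step : ∀ {v w : Vector Carrier 3} → (∀ j → v j ≈ w j) → ∀ j → (v ⊛ N) j ≈ (w ⊛ N) j
    step v≈w j = sum-cong-≋ λ i → *-congʳ {N i j} (v≈w i)

  krylov≋ : ∀ v N → krylov v N ≋ v ∷ v ⊛ N ∷ v ⊛ (N ⊗ N) ∷ []
  krylov≋ v N = λ where
    0F j → refl
    1F j → refl
    2F j → ⊛-assoc v N N j

  -- With S = A - rE this is adj(S) S u = det(S) u, the inner factor being the entry of Su = Au -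
  -- ru.
  det-shift-action : ∀ A u r i → det (shift r A) * u i ≈
    sum (λ k → adjugate (shift r A) i k * (sum (λ l → A k l * u l) + - (r * u k)))
  det-shift-action A u r = λ where
      0F → prove e (l 0F) (s 0F) refl
      1F → prove e (l 1F) (s 1F) refl
      2F → prove e (l 2F) (s 2F) refl
    where
    e = entries A Vec.++ Vec.tabulate u Vec.++ r Vec.∷ Vec.[]
    Ŝ = S.shift (at 12) (mat 0)
    w : Fin 3 → Polynomial 13
    w k = (mat 0 S.⊗ (λ l _ → vec 9 l)) k 0F :+ :- (at 12 :* vec 9 k)
    l s : Fin 3 → Polynomial 13
    l i = S.det Ŝ :* vec 9 i
    s i = (S.adjugate Ŝ S.⊗ (λ k _ → w k)) i 0F

  eigenvalue-root : ∀ {A : Matrix 3} {u r} → (∀ k → sum (λ l → A k l * u l) ≈ r * u k) →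
                    ∀ i → det (shift r A) * u i ≈ 0#
  eigenvalue-root {A} {u} {r} eig i = begin
    det (shift r A) * u i  ≈⟨ det-shift-action A u r i ⟩
    sum (λ k → adjugate (shift r A) i k * (sum (λ l → A k l * u l) + - (r * u k)))
      ≈⟨ sum-cong-≋ (λ k → trans (*-congˡ (trans (+-congʳ (eig k)) (-‿inverseʳ (r * u k))))
                                 (zeroʳ (adjugate (shift r A) i k))) ⟩
    sum {3} (λ k → 0#)     ≈⟨ sum-replicate-zero 3 ⟩
    0#                     ∎

  χ-coeff₀ : ∀ A → coeff (χ A) (0 Vec.∷ Vec.[]) ≈ det A
  χ-coeff₀ A = prove (entries A) (S.coeff (S.χ (mat 0)) (0 Vec.∷ Vec.[])) (S.det (mat 0)) refl

  χ-coeff₁ : ∀ A → coeff (χ A) (1 Vec.∷ Vec.[]) ≈ - σ₂ A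
  χ-coeff₁ A = prove (entries A) (S.coeff (S.χ (mat 0)) (1 Vec.∷ Vec.[])) (:- S.σ₂ (mat 0)) refl

  χ-coeff₂ : ∀ A → coeff (χ A) (2 Vec.∷ Vec.[]) ≈ trace A
  χ-coeff₂ A = prove (entries A) (S.coeff (S.χ (mat 0)) (2 Vec.∷ Vec.[])) (S.trace (mat 0)) refl

-- Polynomials as lists of terms: linear functionals, evaluation and units.

module PolynomialTheory (R : CommutativeRing 0ℓ 0ℓ) where
  open CommutativeRing R
  open PolynomialOver rawRing
  open Exp semiring using (_^_; ^-homo-*)
  open CommutativeSemigroupProperties *-commutativeSemigroup using (x∙yz≈y∙xz; interchange)
  open CommutativeSemigroupProperties +-commutativeSemigroup using () renaming (x∙yz≈y∙xz to x+[y+z]≈y+[x+z])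
  open import Relation.Binary.Reasoning.Setoid setoid

  private
    variable
      k : ℕ

    _≟_ : (d e : Vec ℕ k) → Dec (d ≡ e)
    _≟_ = Vec.≡-dec ℕ._≟_

  infixl 6 _∔_

  _∔_ : Vec ℕ k → Vec ℕ k → Vec ℕ k
  _∔_ = Vec.zipWith ℕ._+_

  -- The linear functional that takes prescribed values on monomials. Evaluation is one instance;
  -- others serve to show that a polynomial is not a unit.
  linear : (Vec ℕ k → Carrier) → Poly k → Carrier
  linear w List.[]            = 0#
  linear w ((c , d) List.∷ p) = c * w d + linear w p

  without : Vec ℕ k → Poly k → Poly k
  without d List.[]            = List.[]
  without d ((c , e) List.∷ p) = if does (e ≟ d) then without d p else (c , e) List.∷ without d p

  length-without : ∀ (d : Vec ℕ k) p → List.length (without d p) ℕ.≤ List.length p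
  length-without d List.[] = ℕ.z≤n
  length-without d ((c , e) List.∷ p) with e ≟ d
  ... | yes _ = ℕ.m≤n⇒m≤1+n (length-without d p)
  ... | no _  = ℕ.s≤s (length-without d p)

  length-without-head : ∀ {c} (d : Vec ℕ k) p → List.length (without d ((c , d) List.∷ p)) ℕ.≤ List.length p
  length-without-head d p with d ≟ d
  ... | yes _  = length-without d p
  ... | no d≢d = contradiction ≡.refl d≢d

  coeff-without-≡ : ∀ (d : Vec ℕ k) p → coeff (without d p) d ≈ 0#
  coeff-without-≡ d List.[] = refl
  coeff-without-≡ d ((c , e) List.∷ p) with e ≟ d in eq
  ... | yes _ = coeff-without-≡ d p
  ... | no _  rewrite eq = coeff-without-≡ d p

  coeff-without-≢ : ∀ {d e : Vec ℕ k} → d ≢ e → ∀ p → coeff (without d p) e ≈ coeff p e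
  coeff-without-≢ d≢e List.[] = refl
  coeff-without-≢ {d = d} {e} d≢e ((c , f) List.∷ p) with f ≟ d
  ... | yes ≡.refl with f ≟ e
  ...   | yes f≡e = contradiction f≡e d≢e
  ...   | no _    = coeff-without-≢ d≢e p
  coeff-without-≢ {d = d} {e} d≢e ((c , f) List.∷ p) | no _ with f ≟ e
  ...   | yes _ = +-congˡ (coeff-without-≢ d≢e p)
  ...   | no _  = coeff-without-≢ d≢e p

  linear-without : ∀ w (d : Vec ℕ k) p → linear w p ≈ coeff p d * w d + linear w (without d p)
  linear-without w d List.[] = sym (trans (+-identityʳ _) (zeroˡ (w d)))
  linear-without w d ((c , e) List.∷ p) with e ≟ d
  ... | yes ≡.refl = begin
    c * w e + linear w p                                      ≈⟨ +-congˡ (linear-without w e p) ⟩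
    c * w e + (coeff p e * w e + linear w (without e p))      ≈⟨ +-assoc _ _ _ ⟨
    c * w e + coeff p e * w e + linear w (without e p)        ≈⟨ +-congʳ (distribʳ (w e) c (coeff p e)) ⟨
    (c + coeff p e) * w e + linear w (without e p)            ∎
  ... | no _ = begin
    c * w e + linear w p                                      ≈⟨ +-congˡ (linear-without w d p) ⟩
    c * w e + (coeff p d * w d + linear w (without d p))      ≈⟨ x+[y+z]≈y+[x+z] _ _ _ ⟩
    coeff p d * w d + (c * w e + linear w (without d p))      ∎

  coeff-without-cong : ∀ (d : Vec ℕ k) p q → (∀ e → coeff p e ≈ coeff q e) →
                       ∀ e → coeff (without d p) e ≈ coeff (without d q) e
  coeff-without-cong d p q p≈q e with d ≟ e
  ... | yes ≡.refl = trans (coeff-without-≡ d p) (sym (coeff-without-≡ d q))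
  ... | no d≢e     = trans (coeff-without-≢ d≢e p) (trans (p≈q e) (sym (coeff-without-≢ d≢e q)))

  -- Induction on the total number of terms. Each step removes from both lists every term with the
  -- exponent of some head term; the removed parts contribute equally because the collected
  -- coefficients agree.
  linear-cong-bounded : ∀ n w (p q : Poly k) → List.length p ℕ.+ List.length q ℕ.≤ n →
                        (∀ e → coeff p e ≈ coeff q e) → linear w p ≈ linear w q
  linear-cong-bounded zero w List.[] List.[] _ _ = refl
  linear-cong-bounded {k} (suc n) w p q size p≈q = step p q size p≈q
    where
    remove : ∀ (d : Vec ℕ k) p q → List.length (without d p) ℕ.+ List.length (without d q) ℕ.≤ n →
             (∀ e → coeff p e ≈ coeff q e) → linear w p ≈ linear w q
    remove d p q size p≈q = begin
      linear w p                                ≈⟨ linear-without w d p ⟩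
      coeff p d * w d + linear w (without d p)  ≈⟨ +-cong (*-congʳ (p≈q d))
        (linear-cong-bounded n w (without d p) (without d q) size (coeff-without-cong d p q p≈q)) ⟩
      coeff q d * w d + linear w (without d q)  ≈⟨ linear-without w d q ⟨
      linear w q                                ∎

    step : ∀ p q → List.length p ℕ.+ List.length q ℕ.≤ suc n →
           (∀ e → coeff p e ≈ coeff q e) → linear w p ≈ linear w q
    step List.[] List.[] _ _ = refl
    step List.[] q@((_ , d) List.∷ q′) (ℕ.s≤s size) =
      remove d List.[] q (ℕ.≤-trans (length-without-head d q′) size)
    step p@((_ , d) List.∷ p′) q (ℕ.s≤s size) =
      remove d p q (ℕ.≤-trans (ℕ.+-mono-≤ (length-without-head d p′) (length-without d q)) size)

  linear-cong : ∀ w (p q : Poly k) → (∀ e → coeff p e ≈ coeff q e) → linear w p ≈ linear w q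
  linear-cong w p q = linear-cong-bounded _ w p q ℕ.≤-refl

  linear-cong-weight : ∀ {v w : Vec ℕ k → Carrier} → (∀ d → v d ≈ w d) → ∀ p → linear v p ≈ linear w p
  linear-cong-weight v≈w List.[]            = refl
  linear-cong-weight v≈w ((c , d) List.∷ p) = +-cong (*-congˡ (v≈w d)) (linear-cong-weight v≈w p)

  linear-++ : ∀ w (p q : Poly k) → linear w (p List.++ q) ≈ linear w p + linear w q
  linear-++ w List.[]            q = sym (+-identityˡ _)
  linear-++ w ((c , d) List.∷ p) q = trans (+-congˡ (linear-++ w p q)) (sym (+-assoc _ _ _))

  linear-*ʳ : ∀ w (p : Poly k) x → linear w p * x ≈ linear (λ d → w d * x) p
  linear-*ʳ w List.[]            x = zeroˡ x
  linear-*ʳ w ((c , d) List.∷ p) x = trans (distribʳ x _ _) (+-cong (*-assoc c (w d) x) (linear-*ʳ w p x))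

  linear-*ˡ : ∀ x w (p : Poly k) → linear (λ d → x * w d) p ≈ x * linear w p
  linear-*ˡ x w List.[]            = sym (zeroʳ x)
  linear-*ˡ x w ((c , d) List.∷ p) = trans (+-cong (x∙yz≈y∙xz c x (w d)) (linear-*ˡ x w p)) (sym (distribˡ x _ _))

  linear-monomial-* : ∀ w c (d : Vec ℕ k) q →
    linear w (List.map (λ (c′ , d′) → c * c′ , d ∔ d′) q) ≈ c * linear (λ d′ → w (d ∔ d′)) q
  linear-monomial-* w c d List.[]              = sym (zeroʳ c)
  linear-monomial-* w c d ((c′ , d′) List.∷ q) =
    trans (+-cong (*-assoc c c′ _) (linear-monomial-* w c d q)) (sym (distribˡ c _ _))

  -- Multiplying by a term of p translates exponents, so that term sees q through a translated
  -- weight.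
  linear-* : ∀ w (p q : Poly k) → let open RawRing (polyRing k) using () renaming (_*_ to _⊠_) in
             linear w (p ⊠ q) ≈ linear (λ d → linear (λ d′ → w (d ∔ d′)) q) p
  linear-* w List.[]            q = refl
  linear-* w ((c , d) List.∷ p) q = trans
    (linear-++ w (List.map (λ (c′ , d′) → c * c′ , d ∔ d′) q) _)
    (+-cong (linear-monomial-* w c d q) (linear-* w p q))

  monomialValue : Vec Carrier k → Vec ℕ k → Carrier
  monomialValue v d = Vec.foldr _ _*_ 1# (Vec.zipWith _^_ v d)

  monomialValue-∔ : ∀ (v : Vec Carrier k) d d′ →
                    monomialValue v (d ∔ d′) ≈ monomialValue v d * monomialValue v d′
  monomialValue-∔ Vec.[] Vec.[] Vec.[] = sym (*-identityˡ 1#)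
  monomialValue-∔ (x Vec.∷ v) (m Vec.∷ d) (n Vec.∷ d′) = trans
    (*-cong (^-homo-* x m n) (monomialValue-∔ v d d′))
    (interchange (x ^ m) (x ^ n) (monomialValue v d) (monomialValue v d′))

  eval-linear : ∀ (p : Poly k) v → eval p v ≡ linear (monomialValue v) p
  eval-linear List.[]            v = ≡.refl
  eval-linear ((c , d) List.∷ p) v = ≡.cong (λ x → c * monomialValue v d + x) (eval-linear p v)

  -- The weight `monomialValue v` is multiplicative in the exponents, which splits the double sum of
  -- `linear-*` into a product.
  eval-* : ∀ (p q : Poly k) v → let open RawRing (polyRing k) using () renaming (_*_ to _⊠_) in
           eval (p ⊠ q) v ≈ eval p v * eval q v
  eval-* {k} p q v = begin
    eval (p ⊠ q) v                                     ≡⟨ eval-linear (p ⊠ q) v ⟩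
    linear w (p ⊠ q)                                   ≈⟨ linear-* w p q ⟩
    linear (λ d → linear (λ d′ → w (d ∔ d′)) q) p      ≈⟨ linear-cong-weight factor p ⟩
    linear (λ d → w d * linear w q) p                  ≈⟨ linear-*ʳ w p (linear w q) ⟨
    linear w p * linear w q                            ≡⟨ ≡.cong₂ _*_ (eval-linear p v) (eval-linear q v) ⟨
    eval p v * eval q v                                ∎
    where
    open RawRing (polyRing k) using () renaming (_*_ to _⊠_)
    w = monomialValue v
    factor : ∀ d → linear (λ d′ → w (d ∔ d′)) q ≈ w d * linear w q
    factor d = trans (linear-cong-weight (monomialValue-∔ v d) q) (linear-*ˡ (w d) w q)

  -- A linear functional that kills every multiple of q but not 1 witnesses
  -- that q is not a unit.
  nonunit : 1# ≉ 0# → ∀ {q : Poly k} w → w (Vec.replicate k 0) ≈ 1# →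
            (∀ d → linear (λ d′ → w (d ∔ d′)) q ≈ 0#) →
            RawSemiringDefs._∤_ (RawRing.rawSemiring (polyRing k)) q (const 1#)
  nonunit {k} 1≉0 {q} w w0≈1 w-kills (RawMagmaDefs._,_ r rq≈1) = 1≉0 (begin
    1#                      ≈⟨ *-identityˡ 1# ⟨
    1# * 1#                 ≈⟨ *-congˡ w0≈1 ⟨
    1# * w (Vec.replicate k 0)         ≈⟨ +-identityʳ _ ⟨
    linear w (const 1#)     ≈⟨ linear-cong w (r ⊠ q) (const 1#) rq≈1 ⟨
    linear w (r ⊠ q)        ≈⟨ linear-* w r q ⟩
    linear (λ d → linear (λ d′ → w (d ∔ d′)) q) r  ≈⟨ linear-cong-weight (λ d → trans (w-kills d) (sym (zeroˡ 0#))) r ⟩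
    -- The zero weight is written as a product so that `linear-*ʳ` can take a factor 0 outside.
    linear (λ d → 0# * 0#) r                       ≈⟨ linear-*ʳ (λ _ → 0#) r 0# ⟨
    linear (λ d → 0#) r * 0#                       ≈⟨ zeroʳ _ ⟩
    0#                      ∎)
    where
    open RawRing (polyRing k) using () renaming (_*_ to _⊠_)

-- An eigenvalue makes the characteristic polynomial reducible.

module EigenvalueFactor (R : CommutativeRing 0ℓ 0ℓ) where
  open CommutativeRing R
  open CubicTheory R
  open PolynomialTheory R
  open Exp semiring using (_^_)

  -- The quotient of the characteristic polynomial by r - X when r is an eigenvalue.
  cofactor : Carrier → Matrix 3 → Poly 1
  cofactor r A =
    (1# , 2 Vec.∷ Vec.[]) List.∷ (r + - trace A , 1 Vec.∷ Vec.[]) List.∷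
    (r * r + - (r * trace A) + σ₂ A , 0 Vec.∷ Vec.[]) List.∷ List.[]

  root-X : Carrier → Poly 1
  root-X r = (r , 0 Vec.∷ Vec.[]) List.∷ (- 1# , 1 Vec.∷ Vec.[]) List.∷ List.[]

  χ-factor : ∀ r A → det (shift r A) ≈ 0# → let open RawRing (polyRing 1) using () renaming (_*_ to _⊠_) in
    ∀ e → coeff (χ A) e ≈ coeff (root-X r ⊠ cofactor r A) e
  χ-factor r A root = λ where
      -- Only the constant coefficients differ, namely by det (A - rE); here the hypothesis on r
      -- enters.
      (0 Vec.∷ Vec.[]) → trans (prove e (l 0) (S.det (S.shift r̂ Â) :+ p 0) refl) (trans (+-congʳ root) (+-identityˡ _))
      (1 Vec.∷ Vec.[]) → prove e (l 1) (p 1) refl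
      (2 Vec.∷ Vec.[]) → prove e (l 2) (p 2) refl
      (3 Vec.∷ Vec.[]) → prove e (l 3) (p 3) refl
      (suc (suc (suc (suc _))) Vec.∷ Vec.[]) → refl
    where
    e = entries A Vec.++ r Vec.∷ Vec.[]
    Â = mat 0
    r̂ = at 9
    l p : ℕ → Polynomial 10
    l k = S.coeff (S.χ Â) (k Vec.∷ Vec.[])
    p k = S.coeff (RawRing._*_ (S.polyRing 1)
      ((r̂ , 0 Vec.∷ Vec.[]) List.∷ (:- con (+ 1) , 1 Vec.∷ Vec.[]) List.∷ List.[])
      ((con (+ 1) , 2 Vec.∷ Vec.[]) List.∷ (r̂ :+ :- S.trace Â , 1 Vec.∷ Vec.[]) List.∷
       (r̂ :* r̂ :+ :- (r̂ :* S.trace Â) :+ S.σ₂ Â , 0 Vec.∷ Vec.[]) List.∷ List.[])) (k Vec.∷ Vec.[])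

  -- The functional sending Xⁿ to the n-th term kills every multiple of X² + bX + c, by the
  -- recurrence, and takes the value 1 at 1, by the initial value.
  recurrence : Carrier → Carrier → ℕ → Carrier
  recurrence b c 0 = 1#
  recurrence b c 1 = 0#
  recurrence b c (suc (suc n)) = - (b * recurrence b c (suc n) + c * recurrence b c n)

  sequence : (ℕ → Carrier) → Vec ℕ 1 → Carrier
  sequence s (n Vec.∷ Vec.[]) = s n

  -- The weight rⁿ is evaluation at r, where r - X vanishes.
  root-X-nonunit : 1# ≉ 0# → ∀ r → RawSemiringDefs._∤_ (RawRing.rawSemiring (polyRing 1)) (root-X r) (const 1#)
  root-X-nonunit 1≉0 r = nonunit 1≉0 (sequence (r ^_)) refl λ where
    -- The exponents arise as n + 0 and n + 1; commuting the summands lets the powers compute.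
    (n Vec.∷ Vec.[]) → ≡.subst₂ (λ i j → r * r ^ i + (- 1# * r ^ j + 0#) ≈ 0#)
      (ℕ.+-comm 0 n) (ℕ.+-comm 1 n)
      (prove (r Vec.∷ r ^ n Vec.∷ Vec.[])
        (at 0 :* at 1 :+ (:- con (+ 1) :* (at 0 :* at 1) :+ con (+ 0))) (con (+ 0)) refl)

  cofactor-nonunit : 1# ≉ 0# → ∀ r A → RawSemiringDefs._∤_ (RawRing.rawSemiring (polyRing 1)) (cofactor r A) (const 1#)
  cofactor-nonunit 1≉0 r A = nonunit 1≉0 (sequence s) refl λ where
      (n Vec.∷ Vec.[]) → ≡.subst₂ (λ i j → 1# * s i + (b * s j + (c * s (n ℕ.+ 0) + 0#)) ≈ 0#)
        (ℕ.+-comm 2 n) (ℕ.+-comm 1 n)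
        (≡.subst (λ i → 1# * s (2 ℕ.+ n) + (b * s (1 ℕ.+ n) + (c * s i + 0#)) ≈ 0#) (ℕ.+-comm 0 n)
        (prove (b Vec.∷ c Vec.∷ s (1 ℕ.+ n) Vec.∷ s n Vec.∷ Vec.[])
          (con (+ 1) :* (:- (at 0 :* at 2 :+ at 1 :* at 3)) :+ (at 0 :* at 2 :+ (at 1 :* at 3 :+ con (+ 0))))
          (con (+ 0)) refl))
    where
    b = r + - trace A
    c = r * r + - (r * trace A) + σ₂ A
    s = recurrence b c

  eigenvalue-reducible : 1# ≉ 0# → ∀ {r A} → det (shift r A) ≈ 0# →
    ¬ RawSemiringDefs.Irreducible (RawRing.rawSemiring (polyRing 1)) (χ A)
  eigenvalue-reducible 1≉0 {r} {A} root irreducible =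
    -- Irreducibility would make one of the two factors a unit.
    [ root-X-nonunit 1≉0 r , cofactor-nonunit 1≉0 r A ]′
      (split-∣1 {x = root-X r} {cofactor r A} (χ-factor r A root))
    where open RawSemiringDefs.Irreducible irreducible

-- The bracket forms on the algebra generated by one matrix.

module FormTheory (R : CommutativeRing 0ℓ 0ℓ) where
  open CommutativeRing R
  open CubicTheory R
  open PolynomialTheory R using (monomialValue)
  open Sum semiring using (sum; sum-cong-≋; *-distribˡ-sum)
  open import Relation.Binary.Reasoning.Setoid setoid

  ⟦⟧-cong : ∀ f {F F′ G G′} → F ≋ F′ → G ≋ G′ → ⟦ f ⟧ F G ≈ ⟦ f ⟧ F′ G′
  ⟦⟧-cong ⟨ (i , j) , (k , l) ⟩ F≋ G≋ =
    +-cong (*-cong (F≋ i j) (G≋ k l)) (-‿cong (*-cong (F≋ k l) (G≋ i j)))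
  ⟦⟧-cong (f ⊞ g) F≋ G≋ = +-cong (⟦⟧-cong f F≋ G≋) (⟦⟧-cong g F≋ G≋)

  -- These are the coefficients of det (v; v; vG), which has two equal rows.
  form-E : ∀ s G → ⟦ form s ⟧ E G ≈ 0#
  form-E = λ where
      0F G → prove (entries G) (l 0F) (con (+ 0)) refl
      1F G → prove (entries G) (l 1F) (con (+ 0)) refl
      2F G → prove (entries G) (l 2F) (con (+ 0)) refl
      3F G → prove (entries G) (l 3F) (con (+ 0)) refl
      4F G → prove (entries G) (l 4F) (con (+ 0)) refl
      5F G → prove (entries G) (l 5F) (con (+ 0)) refl
      6F G → prove (entries G) (l 6F) (con (+ 0)) refl
      7F G → prove (entries G) (l 7F) (con (+ 0)) refl
      8F G → prove (entries G) (l 8F) (con (+ 0)) refl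
      9F G → prove (entries G) (l 9F) (con (+ 0)) refl
    where
    l : Fin 10 → Polynomial 9
    l s = S.⟦ form s ⟧ S.E (mat 0)

  -- Each bracket is bilinear and alternating, so a pair of combinations of A², A, E expands into
  -- the three 2×2 minors of its coordinates.
  ⟦⟧-quadratic : ∀ f α β γ α′ β′ γ′ A →
    ⟦ f ⟧ (quadratic α β γ A) (quadratic α′ β′ γ′ A) ≈
      (β * α′ + - (α * β′)) * ⟦ f ⟧ A (A ⊗ A)
      + ((γ * α′ + - (α * γ′)) * ⟦ f ⟧ E (A ⊗ A) + (γ * β′ + - (β * γ′)) * ⟦ f ⟧ E A)
  ⟦⟧-quadratic ⟨ (i , j) , (k , l) ⟩ α β γ α′ β′ γ′ A = prove
    ((α Vec.∷ β Vec.∷ γ Vec.∷ α′ Vec.∷ β′ Vec.∷ γ′ Vec.∷ Vec.[]) Vec.++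
     ((A ⊗ A) i j Vec.∷ A i j Vec.∷ E i j Vec.∷ (A ⊗ A) k l Vec.∷ A k l Vec.∷ E k l Vec.∷ Vec.[]))
    ((a :* p :+ b :* q :+ c :* e) :* (a′ :* p′ :+ b′ :* q′ :+ c′ :* e′)
      :+ :- ((a :* p′ :+ b :* q′ :+ c :* e′) :* (a′ :* p :+ b′ :* q :+ c′ :* e)))
    ((b :* a′ :+ :- (a :* b′)) :* (q :* p′ :+ :- (q′ :* p))
      :+ ((c :* a′ :+ :- (a :* c′)) :* (e :* p′ :+ :- (e′ :* p))
        :+ (c :* b′ :+ :- (b :* c′)) :* (e :* q′ :+ :- (e′ :* q))))
    refl
    where
    a b c a′ b′ c′ p q e p′ q′ e′ : Polynomial 12
    a = at 0
    b = at 1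
    c = at 2
    a′ = at 3
    b′ = at 4
    c′ = at 5
    p = at 6
    q = at 7
    e = at 8
    p′ = at 9
    q′ = at 10
    e′ = at 11
  ⟦⟧-quadratic (f ⊞ g) α β γ α′ β′ γ′ A = trans
    (+-cong (⟦⟧-quadratic f α β γ α′ β′ γ′ A) (⟦⟧-quadratic g α β γ α′ β′ γ′ A))
    (prove (_ Vec.∷ _ Vec.∷ _ Vec.∷ _ Vec.∷ _ Vec.∷ _ Vec.∷ _ Vec.∷ _ Vec.∷ _ Vec.∷ Vec.[])
      (combine₃ 3F 4F 5F :+ combine₃ 6F 7F 8F)
      (x 0F :* (x 3F :+ x 6F) :+ (x 1F :* (x 4F :+ x 7F) :+ x 2F :* (x 5F :+ x 8F))) refl)
    where
    x : Fin 9 → Polynomial 9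
    x = var
    combine₃ : (i j k : Fin 9) → Polynomial 9
    combine₃ i j k = x 0F :* x i :+ (x 1F :* x j :+ x 2F :* x k)

  -- Of the three minors, the two that pair with E are multiplied by zero by `form-E`.
  form-quadratic : ∀ s α β γ α′ β′ γ′ A →
    ⟦ form s ⟧ (quadratic α β γ A) (quadratic α′ β′ γ′ A) ≈
      (β * α′ + - (α * β′)) * ⟦ form s ⟧ A (A ⊗ A)
  form-quadratic s α β γ α′ β′ γ′ A = begin
    ⟦ form s ⟧ (quadratic α β γ A) (quadratic α′ β′ γ′ A)
      ≈⟨ ⟦⟧-quadratic (form s) α β γ α′ β′ γ′ A ⟩
    c * ⟦ form s ⟧ A (A ⊗ A) + (d * ⟦ form s ⟧ E (A ⊗ A) + e * ⟦ form s ⟧ E A)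
      ≈⟨ +-congˡ (+-cong (vanish d (A ⊗ A)) (vanish e A)) ⟩
    c * ⟦ form s ⟧ A (A ⊗ A) + (0# + 0#)
      ≈⟨ trans (+-congˡ (+-identityˡ 0#)) (+-identityʳ _) ⟩
    c * ⟦ form s ⟧ A (A ⊗ A)  ∎
    where
    c = β * α′ + - (α * β′)
    d = γ * α′ + - (α * γ′)
    e = γ * β′ + - (β * γ′)
    vanish : ∀ r G → r * ⟦ form s ⟧ E G ≈ 0#
    vanish r G = trans (*-congˡ (form-E s G)) (zeroʳ r)

  eval-tabulate : ∀ {k n} (c : Vector Carrier n) (d : Fin n → Vec ℕ k) v →
    eval (List.tabulate λ s → c s , d s) v ≈ sum (λ s → c s * monomialValue v (d s))
  eval-tabulate {n = zero}  c d v = refl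
  eval-tabulate {n = suc n} c d v = +-congˡ (eval-tabulate (λ s → c (Fin.suc s)) (λ s → d (Fin.suc s)) v)

  ternary-scale : ∀ {F G F′ G′} r → (∀ s → ⟦ form s ⟧ F G ≈ r * ⟦ form s ⟧ F′ G′) →
    ∀ v → eval (ternary F G) v ≈ r * eval (ternary F′ G′) v
  ternary-scale {F} {G} {F′} {G′} r scaled v = begin
    eval (ternary F G) v                                     ≈⟨ eval-tabulate (λ s → ⟦ form s ⟧ F G) exponents v ⟩
    sum (λ s → ⟦ form s ⟧ F G * w s)                         ≈⟨ sum-cong-≋ (λ s → trans (*-congʳ (scaled s)) (*-assoc r _ (w s))) ⟩
    sum (λ s → r * (⟦ form s ⟧ F′ G′ * w s))                 ≈⟨ *-distribˡ-sum r (λ s → ⟦ form s ⟧ F′ G′ * w s) ⟨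
    r * sum (λ s → ⟦ form s ⟧ F′ G′ * w s)                   ≈⟨ *-congˡ (eval-tabulate (λ s → ⟦ form s ⟧ F′ G′) exponents v) ⟨
    r * eval (ternary F′ G′) v                               ∎
    where
    w : Fin 10 → Carrier
    w s = monomialValue v (exponents s)

  A≋quadratic : ∀ A → A ≋ quadratic 0# 1# 0# A
  A≋quadratic A i j = prove ((A ⊗ A) i j Vec.∷ A i j Vec.∷ E i j Vec.∷ Vec.[])
    (at 1) (con (+ 0) :* at 0 :+ con (+ 1) :* at 1 :+ con (+ 0) :* at 2) refl

  A²≋quadratic : ∀ A → A ⊗ A ≋ quadratic 1# 0# 0# A
  A²≋quadratic A i j = prove ((A ⊗ A) i j Vec.∷ A i j Vec.∷ E i j Vec.∷ Vec.[])
    (at 0) (con (+ 1) :* at 0 :+ con (+ 0) :* at 1 :+ con (+ 0) :* at 2) refl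

  adjugate≋quadratic : ∀ A → adjugate A ≋ quadratic 1# (- trace A) (σ₂ A) A
  adjugate≋quadratic A = byEntries
    (prove e (l 0F 0F) (r 0F 0F) refl) (prove e (l 0F 1F) (r 0F 1F) refl) (prove e (l 0F 2F) (r 0F 2F) refl)
    (prove e (l 1F 0F) (r 1F 0F) refl) (prove e (l 1F 1F) (r 1F 1F) refl) (prove e (l 1F 2F) (r 1F 2F) refl)
    (prove e (l 2F 0F) (r 2F 0F) refl) (prove e (l 2F 1F) (r 2F 1F) refl) (prove e (l 2F 2F) (r 2F 2F) refl)
    where
    e = entries A
    l = S.adjugate (mat 0)
    r = S.quadratic (con (+ 1)) (:- S.trace (mat 0)) (S.σ₂ (mat 0)) (mat 0)

  -- The adjugate differs from A² by a combination of A and E, and both pair to zero with A.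
  form-adjugate : ∀ s A → ⟦ form s ⟧ A (adjugate A) ≈ ⟦ form s ⟧ A (A ⊗ A)
  form-adjugate s A = begin
    ⟦ form s ⟧ A (adjugate A)
      ≈⟨ ⟦⟧-cong (form s) (A≋quadratic A) (adjugate≋quadratic A) ⟩
    ⟦ form s ⟧ (quadratic 0# 1# 0# A) (quadratic 1# (- trace A) (σ₂ A) A)
      ≈⟨ form-quadratic s 0# 1# 0# 1# (- trace A) (σ₂ A) A ⟩
    (1# * 1# + - (0# * - trace A)) * ⟦ form s ⟧ A (A ⊗ A)
      ≈⟨ prove (trace A Vec.∷ ⟦ form s ⟧ A (A ⊗ A) Vec.∷ Vec.[])
           ((con (+ 1) :* con (+ 1) :+ :- (con (+ 0) :* :- at 0)) :* at 1) (at 1) refl ⟩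
    ⟦ form s ⟧ A (A ⊗ A)  ∎

  quadratic-⊗ : ∀ α β γ A F → quadratic α β γ A ⊗ F ≋ α · (A ⊗ (A ⊗ F)) ⊕ β · (A ⊗ F) ⊕ γ · F
  quadratic-⊗ α β γ A F i j = begin
    (quadratic α β γ A ⊗ F) i j
      ≈⟨ trans (⊗-distribʳ-⊕ (α · (A ⊗ A) ⊕ β · A) (γ · E) F i j) (+-congʳ (⊗-distribʳ-⊕ (α · (A ⊗ A)) (β · A) F i j)) ⟩
    (α · (A ⊗ A) ⊗ F) i j + (β · A ⊗ F) i j + (γ · E ⊗ F) i j
      ≈⟨ +-cong (+-cong (trans (·-⊗ α (A ⊗ A) F i j) (*-congˡ (⊗-assoc A A F i j))) (·-⊗ β A F i j))
                (trans (·-⊗ γ E F i j) (*-congˡ (⊗-identityˡ F i j))) ⟩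
    (α · (A ⊗ (A ⊗ F)) ⊕ β · (A ⊗ F) ⊕ γ · F) i j  ∎

  -- The coefficients of A², A and E in the product of the quadratics with coefficients
  -- (α, β, γ) and (α′, β′, γ′), reduced by the characteristic equation of A.
  module Product (A : Matrix 3) where
    t = trace A
    s = σ₂ A
    d = det A

    square-part linear-part constant-part : (α β γ α′ β′ γ′ : Carrier) → Carrier
    square-part α β γ α′ β′ γ′ =
      α * ((α′ * t + β′) * t + (γ′ + - (α′ * s))) + β * (α′ * t + β′) + γ * α′
    linear-part α β γ α′ β′ γ′ =
      α * (α′ * d + - ((α′ * t + β′) * s)) + β * (γ′ + - (α′ * s)) + γ * β′
    constant-part α β γ α′ β′ γ′ =
      α * ((α′ * t + β′) * d) + β * (α′ * d) + γ * γ′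

    quadratic-⊗-quadratic : ∀ α β γ α′ β′ γ′ →
      quadratic α β γ A ⊗ quadratic α′ β′ γ′ A ≋
      quadratic (square-part α β γ α′ β′ γ′) (linear-part α β γ α′ β′ γ′) (constant-part α β γ α′ β′ γ′) A
    quadratic-⊗-quadratic α β γ α′ β′ γ′ i j = begin
      (quadratic α β γ A ⊗ q) i j
        ≈⟨ quadratic-⊗ α β γ A q i j ⟩
      α * (A ⊗ (A ⊗ q)) i j + β * (A ⊗ q) i j + γ * q i j
        ≈⟨ +-congʳ (+-cong (*-congˡ (trans (⊗-cong {A = A} {A} (λ k l → refl) (⊗-quadratic α′ β′ γ′ A) i j)
                                           (⊗-quadratic _ _ _ A i j)))
                           (*-congˡ (⊗-quadratic α′ β′ γ′ A i j))) ⟩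
      α * quadratic ((α′ * t + β′) * t + (γ′ + - (α′ * s))) (α′ * d + - ((α′ * t + β′) * s)) ((α′ * t + β′) * d) A i j
        + β * quadratic (α′ * t + β′) (γ′ + - (α′ * s)) (α′ * d) A i j + γ * q i j
        -- The blanks are the nine coefficients of the three quadratics, kept as atoms and inferred
        -- from the goal; only a regrouping by A², A and E remains.
        ≈⟨ prove (α Vec.∷ β Vec.∷ γ Vec.∷ (A ⊗ A) i j Vec.∷ A i j Vec.∷ E i j Vec.∷
                  _ Vec.∷ _ Vec.∷ _ Vec.∷ _ Vec.∷ _ Vec.∷ _ Vec.∷ _ Vec.∷ _ Vec.∷ _ Vec.∷ Vec.[])
             (x 0F :* quad 6F 7F 8F :+ x 1F :* quad 9F (# 10) (# 11) :+ x 2F :* quad (# 12) (# 13) (# 14))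
             ((x 0F :* x 6F :+ x 1F :* x 9F :+ x 2F :* x (# 12)) :* x 3F
               :+ (x 0F :* x 7F :+ x 1F :* x (# 10) :+ x 2F :* x (# 13)) :* x 4F
               :+ (x 0F :* x 8F :+ x 1F :* x (# 11) :+ x 2F :* x (# 14)) :* x 5F) refl ⟩
      quadratic (square-part α β γ α′ β′ γ′) (linear-part α β γ α′ β′ γ′) (constant-part α β γ α′ β′ γ′) A i j  ∎
      where
      q = quadratic α′ β′ γ′ A
      x : Fin 15 → Polynomial 15
      x = var
      quad : (a b c : Fin 15) → Polynomial 15
      quad a b c = x a :* x 3F :+ x b :* x 4F :+ x c :* x 5F

    form-square : ∀ α β γ r → let Q = quadratic α β γ A in
      ⟦ form r ⟧ Q (Q ⊗ Q) ≈
      (β * square-part α β γ α β γ + - (α * linear-part α β γ α β γ)) * ⟦ form r ⟧ A (A ⊗ A)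
    form-square α β γ r = trans
      (⟦⟧-cong (form r) (λ i j → refl) (quadratic-⊗-quadratic α β γ α β γ))
      (form-quadratic r α β γ (square-part α β γ α β γ) (linear-part α β γ α β γ) (constant-part α β γ α β γ) A)

  -- The 2×2 determinant in the coordinates of N and N² on A² and A expands to P̄. The scalar part c
  -- cancels from it.
  binary-ternary : ∀ A α β c x y z m n →
    let N = quadratic (n * α) (m + n * β) c A
        v = x Vec.∷ y Vec.∷ z Vec.∷ m Vec.∷ n Vec.∷ Vec.[] in
    eval (ternary N (N ⊗ N)) v ≈
    eval (binary (trace A) (σ₂ A) (det A) α β) v * eval (ternary A (A ⊗ A)) v
  binary-ternary A α β c x y z m n = trans
    (ternary-scale _ (form-square (n * α) (m + n * β) c) (x Vec.∷ y Vec.∷ z Vec.∷ m Vec.∷ n Vec.∷ Vec.[]))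
    (*-congʳ (prove (t Vec.∷ s Vec.∷ d Vec.∷ α Vec.∷ β Vec.∷ c Vec.∷ x Vec.∷ y Vec.∷ z Vec.∷ m Vec.∷ n Vec.∷ Vec.[])
      (w :* (u :* ((u :* t̂ :+ w) :* t̂ :+ (ĉ :+ :- (u :* ŝ))) :+ w :* (u :* t̂ :+ w) :+ ĉ :* u)
        :+ :- (u :* (u :* (u :* d̂ :+ :- ((u :* t̂ :+ w) :* ŝ)) :+ w :* (ĉ :+ :- (u :* ŝ)) :+ ĉ :* w)))
      (S.eval (S.binary t̂ ŝ d̂ α̂ β̂) (at 6 Vec.∷ at 7 Vec.∷ at 8 Vec.∷ m̂ Vec.∷ n̂ Vec.∷ Vec.[])) refl))
    where
    open Product A
    t̂ ŝ d̂ α̂ β̂ ĉ m̂ n̂ u w : Polynomial 11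
    t̂ = at 0
    ŝ = at 1
    d̂ = at 2
    α̂ = at 3
    β̂ = at 4
    ĉ = at 5
    m̂ = at 9
    n̂ = at 10
    u = n̂ :* α̂
    w = m̂ :+ n̂ :* β̂

  -- Both sides are the coefficient at the same monomial in m and n of the form applied to N and N²,
  -- where N = mA + nB. The left side is visibly integral when A and B are; the right side is a
  -- product of coefficients of the two factors of Q.
  mixed-norm : ∀ {A B α β γ} → B ≋ quadratic α β γ A → ∀ s r →
    mixed s (form r) A B ≈ normCoefficient s (trace A) (σ₂ A) (det A) α β * ⟦ form r ⟧ A (A ⊗ A)
  mixed-norm {A} {B} {α} {β} {γ} B≋ s r = coefficient s
    where
    open Product A renaming (s to s₂)
    f = ⟦ form r ⟧ A (A ⊗ A)
    AB : A ⊗ B ≋ quadratic (α * t + β) (γ + - (α * s₂)) (α * d) A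
    AB i j = trans (⊗-cong {A = A} {A} (λ k l → refl) B≋ i j) (⊗-quadratic α β γ A i j)
    BB : B ⊗ B ≋ quadratic (square-part α β γ α β γ) (linear-part α β γ α β γ) (constant-part α β γ α β γ) A
    BB i j = trans (⊗-cong B≋ B≋ i j) (quadratic-⊗-quadratic α β γ α β γ i j)
    A-AB : ⟦ form r ⟧ A (A ⊗ B) ≈ (α * t + β) * f
    A-AB = trans (⟦⟧-cong (form r) (A≋quadratic A) AB) (trans
      (form-quadratic r 0# 1# 0# _ _ _ A) (*-congʳ (prove (α * t + β Vec.∷ γ + - (α * s₂) Vec.∷ Vec.[])
        (con (+ 1) :* at 0 :+ :- (con (+ 0) :* at 1)) (at 0) refl)))
    A-BB : ⟦ form r ⟧ A (B ⊗ B) ≈ square-part α β γ α β γ * f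
    A-BB = trans (⟦⟧-cong (form r) (A≋quadratic A) BB) (trans
      (form-quadratic r 0# 1# 0# _ _ _ A) (*-congʳ (prove (square-part α β γ α β γ Vec.∷ linear-part α β γ α β γ Vec.∷ Vec.[])
        (con (+ 1) :* at 0 :+ :- (con (+ 0) :* at 1)) (at 0) refl)))
    B-AA : ⟦ form r ⟧ B (A ⊗ A) ≈ β * f
    B-AA = trans (⟦⟧-cong (form r) B≋ (A²≋quadratic A)) (trans
      (form-quadratic r α β γ 1# 0# 0# A) (*-congʳ (prove (α Vec.∷ β Vec.∷ Vec.[])
        (at 1 :* con (+ 1) :+ :- (at 0 :* con (+ 0))) (at 1) refl)))
    B-AB : ⟦ form r ⟧ B (A ⊗ B) ≈ (β * (α * t + β) + - (α * (γ + - (α * s₂)))) * f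
    B-AB = trans (⟦⟧-cong (form r) B≋ AB) (form-quadratic r α β γ _ _ _ A)
    B-BB : ⟦ form r ⟧ B (B ⊗ B) ≈ (β * square-part α β γ α β γ + - (α * linear-part α β γ α β γ)) * f
    B-BB = trans (⟦⟧-cong (form r) B≋ BB) (form-quadratic r α β γ _ _ _ A)
    e = t Vec.∷ s₂ Vec.∷ d Vec.∷ α Vec.∷ β Vec.∷ γ Vec.∷ f Vec.∷ Vec.[]
    t̂ ŝ d̂ α̂ β̂ γ̂ f̂ pAB pBB B∧AB B∧BB : Polynomial 7
    t̂ = at 0
    ŝ = at 1
    d̂ = at 2
    α̂ = at 3
    β̂ = at 4
    γ̂ = at 5
    f̂ = at 6
    -- `pAB` and `pBB` are the A²-coordinates of AB and B²; `B∧AB` and `B∧BB` are the coordinate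
    -- minors of B against AB and against B².
    pAB = α̂ :* t̂ :+ β̂
    pBB = α̂ :* (pAB :* t̂ :+ (γ̂ :+ :- (α̂ :* ŝ))) :+ β̂ :* pAB :+ γ̂ :* α̂
    B∧AB = β̂ :* pAB :+ :- (α̂ :* (γ̂ :+ :- (α̂ :* ŝ)))
    B∧BB = β̂ :* pBB :+ :- (α̂ :* (α̂ :* (α̂ :* d̂ :+ :- (pAB :* ŝ)) :+ β̂ :* (γ̂ :+ :- (α̂ :* ŝ)) :+ γ̂ :* β̂))
    nc : Fin 4 → Polynomial 7
    nc i = S.normCoefficient i t̂ ŝ d̂ α̂ β̂
    coefficient : ∀ s → mixed s (form r) A B ≈ normCoefficient s t s₂ d α β * f
    coefficient = λ where
      0F → sym (*-identityˡ _)
      1F → trans (+-cong (+-cong A-AB A-AB) B-AA) (prove e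
        (pAB :* f̂ :+ pAB :* f̂ :+ β̂ :* f̂) (nc 1F :* f̂) refl)
      2F → trans (+-cong (+-cong A-BB B-AB) B-AB) (prove e
        (pBB :* f̂ :+ B∧AB :* f̂ :+ B∧AB :* f̂) (nc 2F :* f̂) refl)
      3F → trans B-BB (prove e (B∧BB :* f̂) (nc 3F :* f̂) refl)

-- Matrices of rank at most one and their vanishing adjugates.

module RankOne (R : CommutativeRing 0ℓ 0ℓ) where
  open CommutativeRing R
  open CubicTheory R
  open FormTheory R
  open GroupProperties +-group using () renaming (x∙y⁻¹≈ε⇒x≈y to x-y≈0⇒x≈y)
  open Sum semiring using (sum; sum-cong-≋; *-distribˡ-sum; *-distribʳ-sum)
  open CommutativeSemigroupProperties *-commutativeSemigroup using (xy∙z≈xz∙y)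
  open import Relation.Binary.Reasoning.Setoid setoid

  -- ρ is the double eigenvalue of A, so A - ρE has rank at most one.
  adjugate-shift-scalar : ∀ {A c₀ c₁} → A ⊗ A ≋ c₀ · E ⊕ c₁ · A →
    let ρ = trace A + - c₁ in
    adjugate (shift ρ A) ≋ (c₀ + (ρ * ρ + - (ρ * trace A) + σ₂ A)) · E
  adjugate-shift-scalar {A} {c₀} {c₁} A² i j = begin
    adjugate (shift ρ A) i j
      ≈⟨ adjugate-shift ρ A i j ⟩
    1# * (A ⊗ A) i j + (ρ + - trace A) * A i j + k * E i j
      ≈⟨ +-congʳ (+-congʳ (*-congˡ (A² i j))) ⟩
    1# * (c₀ * E i j + c₁ * A i j) + (ρ + - trace A) * A i j + k * E i j
      ≈⟨ prove (c₀ Vec.∷ c₁ Vec.∷ trace A Vec.∷ k Vec.∷ A i j Vec.∷ E i j Vec.∷ Vec.[])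
           (con (+ 1) :* (at 0 :* at 5 :+ at 1 :* at 4) :+ (at 2 :+ :- at 1 :+ :- at 2) :* at 4 :+ at 3 :* at 5)
           ((at 0 :+ at 3) :* at 5) refl ⟩
    (c₀ + k) * E i j  ∎
    where
    ρ = trace A + - c₁
    k = ρ * ρ + - (ρ * trace A) + σ₂ A

  -- Substitute kE for the adjugate in S adj(S) = det(S) E.
  scalar-adjugate : ∀ {S : Matrix 3} {k} → adjugate S ≋ k · E → k · S ≋ det S · E
  scalar-adjugate {S} {k} adj i j = begin
    k * S i j            ≈⟨ *-congˡ (⊗-identityʳ S i j) ⟨
    k * (S ⊗ E) i j      ≈⟨ ⊗-· k S E i j ⟨
    (S ⊗ (k · E)) i j      ≈⟨ ⊗-cong {A = S} {S} (λ _ _ → refl) adj i j ⟨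
    (S ⊗ adjugate S) i j ≈⟨ ⊗-adjugate S i j ⟩
    det S * E i j        ∎

  -- Column i of the adjugate consists of the 2×2 minors of the other two rows.
  cross-adjugate : (S : Matrix 3) → (λ p i → cross (S (next i)) (S (next (next i))) p) ≋ adjugate S
  cross-adjugate S = byEntries
    (prove e (l 0F 0F) (r 0F 0F) refl) (prove e (l 0F 1F) (r 0F 1F) refl) (prove e (l 0F 2F) (r 0F 2F) refl)
    (prove e (l 1F 0F) (r 1F 0F) refl) (prove e (l 1F 1F) (r 1F 1F) refl) (prove e (l 1F 2F) (r 1F 2F) refl)
    (prove e (l 2F 0F) (r 2F 0F) refl) (prove e (l 2F 1F) (r 2F 1F) refl) (prove e (l 2F 2F) (r 2F 2F) refl)
    where
    e = entries S
    l r : S.Matrix {9} 3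
    l p i = S.cross (mat 0 (next i)) (mat 0 (next (next i))) p
    r = S.adjugate (mat 0)

  cross-zero : ∀ u w → (∀ p → cross u w p ≈ 0#) → ∀ j l → u j * w l ≈ u l * w j
  cross-zero u w cross≈0 = λ where
    0F 0F → refl
    1F 1F → refl
    2F 2F → refl
    1F 2F → x-y≈0⇒x≈y _ _ (cross≈0 0F)
    2F 0F → x-y≈0⇒x≈y _ _ (cross≈0 1F)
    0F 1F → x-y≈0⇒x≈y _ _ (cross≈0 2F)
    2F 1F → sym (x-y≈0⇒x≈y _ _ (cross≈0 0F))
    0F 2F → sym (x-y≈0⇒x≈y _ _ (cross≈0 1F))
    1F 0F → sym (x-y≈0⇒x≈y _ _ (cross≈0 2F))

  -- Every 2×2 minor of S is, up to sign, an entry of its adjugate. Distinct rows are adjacent in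
  -- cyclic order, possibly after a swap.
  rank-one : ∀ {S : Matrix 3} → adjugate S ≋ O → ∀ i k j l → S i j * S k l ≈ S i l * S k j
  rank-one {S} adj = λ where
      0F 0F j l → *-comm _ _
      1F 1F j l → *-comm _ _
      2F 2F j l → *-comm _ _
      1F 2F j l → adjacent 0F j l
      2F 0F j l → adjacent 1F j l
      0F 1F j l → adjacent 2F j l
      2F 1F j l → swapped 0F j l
      0F 2F j l → swapped 1F j l
      1F 0F j l → swapped 2F j l
    where
    adjacent : ∀ i j l → S (next i) j * S (next (next i)) l ≈ S (next i) l * S (next (next i)) j
    adjacent i = cross-zero (S (next i)) (S (next (next i))) λ p → trans (cross-adjugate S p i) (adj p i)
    swapped : ∀ i j l → S (next (next i)) j * S (next i) l ≈ S (next (next i)) l * S (next i) j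
    swapped i j l = trans (*-comm _ _) (trans (adjacent i l j) (*-comm _ _))

  -- Every column of S is a multiple of every nonzero one, and C preserves the column space.
  rank-one-eigenvector : ∀ {S C : Matrix 3} → adjugate S ≋ O → Commutes S C →
    ∀ i j k → S i j * (C ⊗ S) k j ≈ (S ⊗ C) i j * S k j
  rank-one-eigenvector {S} {C} adj SC i j k = begin
    S i j * (C ⊗ S) k j                       ≈⟨ *-congˡ (SC k j) ⟨
    S i j * (S ⊗ C) k j                       ≈⟨ *-distribˡ-sum (S i j) (λ l → S k l * C l j) ⟩
    sum (λ l → S i j * (S k l * C l j))       ≈⟨ sum-cong-≋ (λ l → exchange l) ⟩
    sum (λ l → S i l * C l j * S k j)         ≈⟨ *-distribʳ-sum (S k j) (λ l → S i l * C l j) ⟨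
    (S ⊗ C) i j * S k j                       ∎
    where
    exchange : ∀ l → S i j * (S k l * C l j) ≈ S i l * C l j * S k j
    exchange l = begin
      S i j * (S k l * C l j)   ≈⟨ *-assoc _ _ _ ⟨
      S i j * S k l * C l j     ≈⟨ *-congʳ (rank-one adj i k j l) ⟩
      S i l * S k j * C l j     ≈⟨ xy∙z≈xz∙y _ _ _ ⟩
      S i l * C l j * S k j     ∎

-- Conjugation and commutation in a monoid.

module Conjugation {c ℓ} (M : Monoid c ℓ) where
  open Monoid M
  open import Relation.Binary.Reasoning.Setoid setoid

  -- From xn = mx follows ym = ny. Hence m moves leftwards past y as n, past c by commutation, and
  -- past x as m again.
  conjugate-commutes : ∀ {x y m n c} → x ∙ y ≈ ε → x ∙ n ≈ m ∙ x → n ∙ c ≈ c ∙ n →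
                       y ∙ x ≈ ε → (x ∙ c ∙ y) ∙ m ≈ m ∙ (x ∙ c ∙ y)
  conjugate-commutes {x} {y} {m} {n} {c} xy xn nc yx = begin
    (x ∙ c ∙ y) ∙ m            ≈⟨ assoc _ _ _ ⟩
    x ∙ c ∙ (y ∙ m)            ≈⟨ ∙-congˡ ym ⟩
    x ∙ c ∙ (n ∙ y)            ≈⟨ assoc _ _ _ ⟨
    x ∙ c ∙ n ∙ y              ≈⟨ ∙-congʳ (trans (assoc _ _ _) (∙-congˡ (sym nc))) ⟩
    x ∙ (n ∙ c) ∙ y            ≈⟨ ∙-congʳ (trans (sym (assoc _ _ _)) (trans (∙-congʳ xn) (assoc _ _ _))) ⟩
    m ∙ (x ∙ c) ∙ y            ≈⟨ assoc _ _ _ ⟩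
    m ∙ (x ∙ c ∙ y)            ∎
    where
    ym : y ∙ m ≈ n ∙ y
    ym = begin
      y ∙ m              ≈⟨ identityʳ _ ⟨
      y ∙ m ∙ ε          ≈⟨ ∙-congˡ xy ⟨
      y ∙ m ∙ (x ∙ y)    ≈⟨ trans (assoc _ _ _) (∙-congˡ (sym (assoc _ _ _))) ⟩
      y ∙ (m ∙ x ∙ y)    ≈⟨ ∙-congˡ (∙-congʳ xn) ⟨
      y ∙ (x ∙ n ∙ y)    ≈⟨ trans (∙-congˡ (assoc _ _ _)) (sym (assoc _ _ _)) ⟩
      y ∙ x ∙ (n ∙ y)    ≈⟨ ∙-congʳ yx ⟩
      ε ∙ (n ∙ y)        ≈⟨ identityˡ _ ⟩
      n ∙ y              ∎

  conjugate-intertwines : ∀ {x y} m → x ∙ y ≈ ε → x ∙ (y ∙ m ∙ x) ≈ m ∙ x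
  conjugate-intertwines {x} {y} m xy = begin
    x ∙ (y ∙ m ∙ x)    ≈⟨ trans (∙-congˡ (assoc _ _ _)) (sym (assoc _ _ _)) ⟩
    x ∙ y ∙ (m ∙ x)    ≈⟨ ∙-congʳ xy ⟩
    ε ∙ (m ∙ x)        ≈⟨ identityˡ _ ⟩
    m ∙ x              ∎

  -- Inserting yx = ε to the right of c rebuilds xcy, which moves past m; the yx left in front then
  -- cancels.
  commutes-conjugate : ∀ {x y m c} → y ∙ x ≈ ε → (x ∙ c ∙ y) ∙ m ≈ m ∙ (x ∙ c ∙ y) →
                       (y ∙ m ∙ x) ∙ c ≈ c ∙ (y ∙ m ∙ x)
  commutes-conjugate {x} {y} {m} {c} yx h = begin
    (y ∙ m ∙ x) ∙ c              ≈⟨ identityʳ _ ⟨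
    (y ∙ m ∙ x) ∙ c ∙ ε          ≈⟨ ∙-congˡ yx ⟨
    (y ∙ m ∙ x) ∙ c ∙ (y ∙ x)    ≈⟨ assoc _ _ _ ⟨
    (y ∙ m ∙ x) ∙ c ∙ y ∙ x      ≈⟨ ∙-congʳ (trans (∙-congʳ (assoc _ _ _)) (assoc _ _ _)) ⟩
    y ∙ m ∙ (x ∙ c ∙ y) ∙ x      ≈⟨ ∙-congʳ (trans (assoc _ _ _) (∙-congˡ (sym h))) ⟩
    y ∙ ((x ∙ c ∙ y) ∙ m) ∙ x    ≈⟨ ∙-congʳ (sym (assoc _ _ _)) ⟩
    y ∙ (x ∙ c ∙ y) ∙ m ∙ x      ≈⟨ ∙-congʳ (∙-congʳ (trans (∙-congˡ (assoc _ _ _))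
        (trans (sym (assoc _ _ _)) (trans (∙-congʳ yx) (identityˡ _))))) ⟩
    c ∙ y ∙ m ∙ x                ≈⟨ trans (∙-congʳ (assoc _ _ _)) (assoc _ _ _) ⟩
    c ∙ (y ∙ m ∙ x)              ∎

-- Instances over the integers and the rationals.

module ℤT where
  open CubicTheory ℤ.+-*-commutativeRing public
  open FormTheory ℤ.+-*-commutativeRing public
  open RankOne ℤ.+-*-commutativeRing public
  open Conjugation matrixMonoid public

module ℚT where
  open CubicTheory ℚ.+-*-commutativeRing public
  open PolynomialTheory ℚ.+-*-commutativeRing public using (eval-*)
  open FormTheory ℚ.+-*-commutativeRing public
  open EigenvalueFactor ℚ.+-*-commutativeRing public

-- The embedding of the integers in the rationals.

toℚᵘ-toℚ : ∀ i → ℚ.toℚᵘ (toℚ i) ℚᵘ.≃ ℚᵘ.mkℚᵘ i 0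
toℚᵘ-toℚ i = ℚ.toℚᵘ-fromℚᵘ (ℚᵘ.mkℚᵘ i 0)

-- Since `toℚ` normalises by a gcd, the homomorphism laws are checked on unnormalised fractions with
-- denominator 1.
toℚ-+ : ∀ i j → toℚ (i ℤ.+ j) ≡ toℚ i ℚ.+ toℚ j
toℚ-+ i j = ℚ.toℚᵘ-injective (begin
  ℚ.toℚᵘ (toℚ (i ℤ.+ j))                      ≈⟨ toℚᵘ-toℚ (i ℤ.+ j) ⟩
  ℚᵘ.mkℚᵘ (i ℤ.+ j) 0                         ≈⟨ ℚᵘ.*≡* (≡.cong (ℤ._* + 1)
                                                   (≡.sym (≡.cong₂ ℤ._+_ (ℤ.*-identityʳ i) (ℤ.*-identityʳ j)))) ⟩
  ℚᵘ.mkℚᵘ i 0 ℚᵘ.+ ℚᵘ.mkℚᵘ j 0                ≈⟨ ℚᵘ.+-cong (toℚᵘ-toℚ i) (toℚᵘ-toℚ j) ⟨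
  ℚ.toℚᵘ (toℚ i) ℚᵘ.+ ℚ.toℚᵘ (toℚ j)          ≈⟨ ℚ.toℚᵘ-homo-+ (toℚ i) (toℚ j) ⟨
  ℚ.toℚᵘ (toℚ i ℚ.+ toℚ j)                    ∎)
  where open import Relation.Binary.Reasoning.Setoid ℚᵘ.≃-setoid

toℚ-* : ∀ i j → toℚ (i ℤ.* j) ≡ toℚ i ℚ.* toℚ j
toℚ-* i j = ℚ.toℚᵘ-injective (begin
  ℚ.toℚᵘ (toℚ (i ℤ.* j))                      ≈⟨ toℚᵘ-toℚ (i ℤ.* j) ⟩
  ℚᵘ.mkℚᵘ i 0 ℚᵘ.* ℚᵘ.mkℚᵘ j 0                ≈⟨ ℚᵘ.*-cong (toℚᵘ-toℚ i) (toℚᵘ-toℚ j) ⟨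
  ℚ.toℚᵘ (toℚ i) ℚᵘ.* ℚ.toℚᵘ (toℚ j)          ≈⟨ ℚ.toℚᵘ-homo-* (toℚ i) (toℚ j) ⟨
  ℚ.toℚᵘ (toℚ i ℚ.* toℚ j)                    ∎)
  where open import Relation.Binary.Reasoning.Setoid ℚᵘ.≃-setoid

toℚ-neg : ∀ i → toℚ (ℤ.- i) ≡ ℚ.- toℚ i
toℚ-neg i = ℚ.toℚᵘ-injective (begin
  ℚ.toℚᵘ (toℚ (ℤ.- i))       ≈⟨ toℚᵘ-toℚ (ℤ.- i) ⟩
  ℚᵘ.- ℚᵘ.mkℚᵘ i 0           ≈⟨ ℚᵘ.-‿cong (toℚᵘ-toℚ i) ⟨
  ℚᵘ.- ℚ.toℚᵘ (toℚ i)        ≈⟨ ℚ.toℚᵘ-homo‿- (toℚ i) ⟨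
  ℚ.toℚᵘ (ℚ.- toℚ i)         ∎)
  where open import Relation.Binary.Reasoning.Setoid ℚᵘ.≃-setoid

toℚ-injective : ∀ {i j} → toℚ i ≡ toℚ j → i ≡ j
toℚ-injective {i} {j} eq with ℚᵘ.*≡* i1≡j1 ← ℚ./-injective-≃ (ℚᵘ.mkℚᵘ i 0) (ℚᵘ.mkℚᵘ j 0) eq =
  ≡.trans (≡.sym (ℤ.*-identityʳ i)) (≡.trans i1≡j1 (ℤ.*-identityʳ j))

toℚ-⊗ : ∀ A B → toMatℚ (ℤT._⊗_ A B) ℚT.≋ toMatℚ A ℚT.⊗ toMatℚ B
toℚ-⊗ A B i j = toℚ-sum (λ k → A i k ℤ.* B k j) (λ k → toℚ-* (A i k) (B k j))
  where
  open RawSemiringDefs using (sum)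
  toℚ-sum : ∀ {n} (f : Vector ℤ n) {g : Vector ℚ n} → (∀ k → toℚ (f k) ≡ g k) →
            toℚ (sum (RawRing.rawSemiring ℤ.+-*-rawRing) f) ≡ sum (RawRing.rawSemiring ℚ.+-*-rawRing) g
  toℚ-sum {zero}  f f≡g = ≡.refl
  toℚ-sum {suc n} f f≡g = ≡.trans (toℚ-+ (f 0F) _)
    (≡.cong₂ ℚ._+_ (f≡g 0F) (toℚ-sum (λ k → f (Fin.suc k)) (λ k → f≡g (Fin.suc k))))

toℚ-E : ∀ {n} → (λ i j → toℚ (ℤM.E {n} i j)) ℚM.≋ ℚM.E
toℚ-E i j with i Fin.≟ j
... | yes _ = ≡.refl
... | no _  = ≡.refl

toℚ-⟦⟧ : ∀ f F G → toℚ (ℤT.⟦ f ⟧ F G) ≡ ℚT.⟦ f ⟧ (toMatℚ F) (toMatℚ G)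
toℚ-⟦⟧ ⟨ (i , j) , (k , l) ⟩ F G = ≡.trans (toℚ-+ (F i j ℤ.* G k l) (ℤ.- (F k l ℤ.* G i j)))
  (≡.cong₂ ℚ._+_ (toℚ-* (F i j) (G k l)) (≡.trans (toℚ-neg (F k l ℤ.* G i j)) (≡.cong ℚ.-_ (toℚ-* (F k l) (G i j)))))
toℚ-⟦⟧ (f ⊞ g) F G = ≡.trans (toℚ-+ (ℤT.⟦ f ⟧ F G) (ℤT.⟦ g ⟧ F G)) (≡.cong₂ ℚ._+_ (toℚ-⟦⟧ f F G) (toℚ-⟦⟧ g F G))

mapCoefficients : ∀ {k} → ℤP.Poly k → ℚP.Poly k
mapCoefficients = List.map (map₁ toℚ)

tabulate-cong : ∀ {A : Set} {n} {f g : Fin n → A} → (∀ i → f i ≡ g i) → List.tabulate f ≡ List.tabulate g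
tabulate-cong {n = zero}  f≡g = ≡.refl
tabulate-cong {n = suc n} f≡g = ≡.cong₂ List._∷_ (f≡g 0F) (tabulate-cong (λ i → f≡g (Fin.suc i)))

mapCoefficients-ternary : ∀ F G → mapCoefficients (ℤT.ternary F G) ≡ ℚT.ternary (toMatℚ F) (toMatℚ G)
mapCoefficients-ternary F G = ≡.trans
  (List.map-tabulate (λ s → ℤT.⟦ form s ⟧ F G , exponents s) (map₁ toℚ))
  (tabulate-cong λ s → ≡.cong (_, exponents s) (toℚ-⟦⟧ (form s) F G))

toℚ-eval : ∀ {k} (p : ℤP.Poly k) v → ℚT.eval (mapCoefficients p) (Vec.map toℚ v) ≡ toℚ (ℤT.eval p v)
toℚ-eval List.[]            v = ≡.refl
toℚ-eval ((c , d) List.∷ p) v = ≡.sym (≡.trans (toℚ-+ (c ℤ.* _) (ℤT.eval p v))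
  (≡.cong₂ ℚ._+_ (≡.trans (toℚ-* c _) (≡.cong (toℚ c ℚ.*_) (toℚ-monomial v d))) (≡.sym (toℚ-eval p v))))
  where
  module ℤ^ = RawSemiringDefs (RawRing.rawSemiring ℤ.+-*-rawRing)
  module ℚ^ = RawSemiringDefs (RawRing.rawSemiring ℚ.+-*-rawRing)
  toℚ-^ : ∀ x n → toℚ (x ℤ^.^ n) ≡ toℚ x ℚ^.^ n
  toℚ-^ x zero    = ≡.refl
  toℚ-^ x (suc n) = ≡.trans (toℚ-* x (x ℤ^.^ n)) (≡.cong (toℚ x ℚ.*_) (toℚ-^ x n))
  toℚ-monomial : ∀ {k} (v : Vec ℤ k) d → toℚ (Vec.foldr _ ℤ._*_ (+ 1) (Vec.zipWith ℤ^._^_ v d)) ≡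
                 Vec.foldr _ ℚ._*_ 1ℚ (Vec.zipWith ℚ^._^_ (Vec.map toℚ v) d)
  toℚ-monomial Vec.[]      Vec.[]      = ≡.refl
  toℚ-monomial (x Vec.∷ v) (n Vec.∷ d) =
    ≡.trans (toℚ-* (x ℤ^.^ n) _) (≡.cong₂ ℚ._*_ (toℚ-^ x n) (toℚ-monomial v d))

toℚ-combination : ∀ a b c (F G H : Matℤ) i j →
  toℚ ((a ℤM.· F ℤM.⊕ (b ℤM.· G ℤM.⊕ c ℤM.· H)) i j) ≡
  (toℚ a ℚM.· toMatℚ F ℚM.⊕ (toℚ b ℚM.· toMatℚ G ℚM.⊕ toℚ c ℚM.· toMatℚ H)) i j
toℚ-combination a b c F G H i j = ≡.trans (toℚ-+ (a ℤ.* F i j) _) (≡.cong₂ ℚ._+_ (toℚ-* a (F i j))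
  (≡.trans (toℚ-+ (b ℤ.* G i j) (c ℤ.* H i j)) (≡.cong₂ ℚ._+_ (toℚ-* b (G i j)) (toℚ-* c (H i j)))))

-- Q as a product of a binary and a ternary form.

P̃-adjugate : ∀ A → P̃ A (ℤM.adjugate A) ≡ ℤT.ternary A (ℤT._⊗_ A A)
P̃-adjugate A = ≡.trans
  -- The first nine coefficients already have the shape given by `form`; only that of xyz has to be
  -- rewritten.
  (≡.cong (λ c → List.take 9 (ternary A (adjugate A)) List.++ (c , exponents 9F) List.∷ List.[])
    (prove (entries A) xyz (S.⟦ form 9F ⟧ (mat 0) (S.adjugate (mat 0))) ≡.refl))
  (tabulate-cong λ s → ≡.cong (_, exponents s) (form-adjugate s A))
  where
  open ℤT
  xyz : Polynomial 9
  xyz = bracket (0F , 0F) (1F , 1F) :+ bracket (1F , 1F) (2F , 2F) :+ bracket (2F , 2F) (0F , 0F)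
          :+ con (+ 3) :* bracket (0F , 2F) (2F , 0F)
    where
    bracket : Cell → Cell → Polynomial 9
    bracket a b = S.⟦ ⟨ a , b ⟩ ⟧ (mat 0) (S.adjugate (mat 0))

open RawRing (ℚP.polyRing 5) using () renaming (_*_ to infixl 7 _⊠_)

P̄-binary : ∀ A B q → let open QuadraticExpression q using (α; β); Aℚ = toMatℚ A in
  P̄ A B q ≡ ℚT.binary (ℚT.trace Aℚ) (ℚT.σ₂ Aℚ) (ℚT.det Aℚ) α β
P̄-binary A B q = begin
  -- The numerals 2, 3, 4 and the corresponding sums of ones compute to the same rationals.
  P̄ A B q                                        ≡⟨⟩
  ℚT.binary (c 2) (ℚ.- c 1) (c 0) α β             ≡⟨ ≡.cong (λ a → ℚT.binary a (ℚ.- c 1) (c 0) α β) (ℚT.χ-coeff₂ Aℚ) ⟩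
  ℚT.binary t (ℚ.- c 1) (c 0) α β                 ≡⟨ ≡.cong (λ a → ℚT.binary t (ℚ.- a) (c 0) α β) (ℚT.χ-coeff₁ Aℚ) ⟩
  ℚT.binary t (ℚ.- (ℚ.- s)) (c 0) α β             ≡⟨ ≡.cong₂ (λ a b → ℚT.binary t a b α β)
                                                    (GroupProperties.⁻¹-involutive ℚ.+-0-group s) (ℚT.χ-coeff₀ Aℚ) ⟩
  ℚT.binary t s (ℚT.det Aℚ) α β                   ∎
  where
  open ≡.≡-Reasoning
  open QuadraticExpression q using (α; β)
  Aℚ = toMatℚ A
  t  = ℚT.trace Aℚ
  s  = ℚT.σ₂ Aℚ
  c : ℕ → ℚ
  c k = ℚP.coeff (charPoly Aℚ) (k Vec.∷ Vec.[])

Q-factors : ∀ A B q → let open QuadraticExpression q using (α; β); Aℚ = toMatℚ A in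
  Q A B q ≡ ℚT.binary (ℚT.trace Aℚ) (ℚT.σ₂ Aℚ) (ℚT.det Aℚ) α β ⊠ ℚT.ternary Aℚ (ℚT._⊗_ Aℚ Aℚ)
Q-factors A B q = ≡.cong₂ _⊠_ (P̄-binary A B q) (begin
  mapCoefficients (P̃ A (ℤM.adjugate A))             ≡⟨ ≡.cong mapCoefficients (P̃-adjugate A) ⟩
  mapCoefficients (ℤT.ternary A (ℤT._⊗_ A A))        ≡⟨ mapCoefficients-ternary A (ℤT._⊗_ A A) ⟩
  ℚT.ternary Aℚ (toMatℚ (ℤT._⊗_ A A))               ≡⟨ tabulate-cong (λ s → ≡.cong (_, exponents s)
                                                          (ℚT.⟦⟧-cong (form s) {Aℚ} {Aℚ} (λ _ _ → ≡.refl) (toℚ-⊗ A A))) ⟩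
  ℚT.ternary Aℚ (ℚT._⊗_ Aℚ Aℚ)                      ∎)
  where
  open ≡.≡-Reasoning
  Aℚ = toMatℚ A

-- Integrality of the coefficients of Q.

Integral : ℚ → Set
Integral r = ∃[ c ] r ≡ toℚ c

-- A collected coefficient is a sum of coefficients of terms, so it suffices that each term is
-- integral.
integral-terms : ∀ {k} {p : ℚP.Poly k} → All (λ t → Integral (proj₁ t)) p → HasIntegerCoefficients p
integral-terms All.[] e = + 0 , ≡.refl
integral-terms {p = (_ , d) List.∷ p} ((c , ≡.refl) All.∷ terms) e
  with Vec.≡-dec ℕ._≟_ d e | integral-terms terms e
... | yes _ | c′ , eq = c ℤ.+ c′ , ≡.trans (≡.cong (toℚ c ℚ.+_) eq) (≡.sym (toℚ-+ c c′))
... | no _  | c′ , eq = c′ , eq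

integral-product : ∀ {k} (p q : ℚP.Poly k) → let open RawRing (ℚP.polyRing k) using () renaming (_*_ to _⊗_) in
  All (λ t → All (λ t′ → Integral (proj₁ t ℚ.* proj₁ t′)) q) p → All (λ t → Integral (proj₁ t)) (p ⊗ q)
integral-product p q pq = All.concat⁺ (All.map⁺ (All.map (λ tq → All.map⁺ tq) pq))

-- `mixed` is built from matrix entries by ring operations only, so it commutes with `toℚ`.
mixed-integral : ∀ s f A B → Integral (ℚT.mixed s f (toMatℚ A) (toMatℚ B))
mixed-integral s f A B = ℤT.mixed s f A B , ≡.sym (toℚ-mixed s)
  where
  open ℤT using (_⊗_)
  toℚ-⟦⟧⊗ : ∀ F G H → toℚ (ℤT.⟦ f ⟧ F (G ⊗ H)) ≡ ℚT.⟦ f ⟧ (toMatℚ F) (ℚT._⊗_ (toMatℚ G) (toMatℚ H))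
  toℚ-⟦⟧⊗ F G H = ≡.trans (toℚ-⟦⟧ f F (G ⊗ H)) (ℚT.⟦⟧-cong f (λ _ _ → ≡.refl) (toℚ-⊗ G H))
  toℚ-+₃ : ∀ i j k {x y z} → toℚ i ≡ x → toℚ j ≡ y → toℚ k ≡ z → toℚ (i ℤ.+ j ℤ.+ k) ≡ x ℚ.+ y ℚ.+ z
  toℚ-+₃ i j k ≡.refl ≡.refl ≡.refl = ≡.trans (toℚ-+ (i ℤ.+ j) k) (≡.cong (ℚ._+ toℚ k) (toℚ-+ i j))
  toℚ-mixed : ∀ s → toℚ (ℤT.mixed s f A B) ≡ ℚT.mixed s f (toMatℚ A) (toMatℚ B)
  toℚ-mixed 0F = toℚ-⟦⟧⊗ A A A
  toℚ-mixed 1F = toℚ-+₃ (ℤT.⟦ f ⟧ A (A ⊗ B)) (ℤT.⟦ f ⟧ A (A ⊗ B)) (ℤT.⟦ f ⟧ B (A ⊗ A))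
    (toℚ-⟦⟧⊗ A A B) (toℚ-⟦⟧⊗ A A B) (toℚ-⟦⟧⊗ B A A)
  toℚ-mixed 2F = toℚ-+₃ (ℤT.⟦ f ⟧ A (B ⊗ B)) (ℤT.⟦ f ⟧ B (A ⊗ B)) (ℤT.⟦ f ⟧ B (A ⊗ B))
    (toℚ-⟦⟧⊗ A B B) (toℚ-⟦⟧⊗ B A B) (toℚ-⟦⟧⊗ B A B)
  toℚ-mixed 3F = toℚ-⟦⟧⊗ B B B

-- The coefficients of P̄ are given only as rationals, but their products with those of the ternary
-- form are values of `mixed` at integer matrices.
coefficient-products-integral : ∀ {A B α β γ} → toMatℚ B ℚM.≋ ℚT.quadratic α β γ (toMatℚ A) →
  let Aℚ = toMatℚ A in ∀ s r →
  Integral (ℚT.normCoefficient s (ℚT.trace Aℚ) (ℚT.σ₂ Aℚ) (ℚT.det Aℚ) α β ℚ.* ℚT.⟦ form r ⟧ Aℚ (ℚT._⊗_ Aℚ Aℚ))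
coefficient-products-integral {A} {B} {α} {β} {γ} B≋ s r =
  ≡.subst Integral (ℚT.mixed-norm {toMatℚ A} {toMatℚ B} {α} {β} {γ} B≋ s r) (mixed-integral s (form r) A B)

all-products : ∀ {t σ d α β F G} →
  (∀ s r → Integral (ℚT.normCoefficient s t σ d α β ℚ.* ℚT.⟦ form r ⟧ F G)) →
  All (λ t → All (λ t′ → Integral (proj₁ t ℚ.* proj₁ t′)) (ℚT.ternary F G)) (ℚT.binary t σ d α β)
all-products {t} {σ} {d} {α} {β} {F} {G} integral =
  All.tabulate⁺ {f = λ s → ℚT.normCoefficient s t σ d α β , normExponents s} λ s →
  All.tabulate⁺ {f = λ r → ℚT.⟦ form r ⟧ F G , exponents r} (integral s)

Q-integral : ∀ A B q → HasIntegerCoefficients (Q A B q)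
Q-integral A B q = integral-terms {p = Q A B q}
  (≡.subst (All (λ t → Integral (proj₁ t))) (≡.sym (Q-factors A B q))
  (integral-product (ℚT.binary (ℚT.trace Aℚ) (ℚT.σ₂ Aℚ) (ℚT.det Aℚ) α β) (ℚT.ternary Aℚ (ℚT._⊗_ Aℚ Aℚ))
    (all-products {ℚT.trace Aℚ} {ℚT.σ₂ Aℚ} {ℚT.det Aℚ} {α} {β} {Aℚ} {ℚT._⊗_ Aℚ Aℚ}
      (coefficient-products-integral {A} {B} {α} {β} {γ} equation))))
  where
  open QuadraticExpression q
  Aℚ = toMatℚ A

-- Values of Q as integer determinants.

eval-ternary-square : ∀ {N Nℚ} → toMatℚ N ℚM.≋ Nℚ → ∀ x y z m n →
  ℚT.eval (ℚT.ternary Nℚ (ℚT._⊗_ Nℚ Nℚ)) (Vec.map toℚ (x Vec.∷ y Vec.∷ z Vec.∷ m Vec.∷ n Vec.∷ Vec.[])) ≡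
  toℚ (ℤT.det (ℤT.krylov (x ∷ y ∷ z ∷ []) N))
eval-ternary-square {N} {Nℚ} N≋ x y z m n = begin
  ℚT.eval (ℚT.ternary Nℚ (ℚT._⊗_ Nℚ Nℚ)) w
    ≡⟨ ≡.cong (λ p → ℚT.eval p w) (tabulate-cong λ s → ≡.cong (_, exponents s)
         (ℚT.⟦⟧-cong (form s) {toMatℚ N} {Nℚ} N≋ N²≋)) ⟨
  ℚT.eval (ℚT.ternary (toMatℚ N) (toMatℚ (N ⊗ N))) w
    ≡⟨ ≡.cong (λ p → ℚT.eval p w) (mapCoefficients-ternary N (N ⊗ N)) ⟨
  ℚT.eval (mapCoefficients (ℤT.ternary N (N ⊗ N))) w
    ≡⟨ toℚ-eval (ℤT.ternary N (N ⊗ N)) v ⟩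
  toℚ (ℤT.eval (ℤT.ternary N (N ⊗ N)) v)
    ≡⟨ ≡.cong toℚ (ℤT.ternary-det N (N ⊗ N) x y z m n) ⟩
  toℚ (ℤT.det ((x ∷ y ∷ z ∷ []) ∷ (x ∷ y ∷ z ∷ []) ⊛ N ∷ (x ∷ y ∷ z ∷ []) ⊛ (N ⊗ N) ∷ []))
    ≡⟨ ≡.cong toℚ (ℤT.det-cong (ℤT.krylov≋ (x ∷ y ∷ z ∷ []) N)) ⟨
  toℚ (ℤT.det (ℤT.krylov (x ∷ y ∷ z ∷ []) N))  ∎
  where
  open ≡.≡-Reasoning
  open ℤT using (_⊗_; _⊛_)
  v = x Vec.∷ y Vec.∷ z Vec.∷ m Vec.∷ n Vec.∷ Vec.[]
  w = Vec.map toℚ v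
  N²≋ : toMatℚ (N ⊗ N) ℚM.≋ ℚT._⊗_ Nℚ Nℚ
  N²≋ i j = ≡.trans (toℚ-⊗ N N i j) (ℚT.⊗-cong N≋ N≋ i j)

-- Proved for a variable p: on a concrete polynomial both sides unfold before they are compared.
eval-ℚP : ∀ {k} (p : ℚP.Poly k) v → ℚP.eval p v ≡ ℚT.eval p v
eval-ℚP p v = ≡.refl

-- The scalar part c of N is left free: a matrix conjugate to a Frobenius matrix brings its own,
-- while a solution of the equation prescribes only m and n.
eval-Q : ∀ A B q c x y z m n N → N ℤM.≋ c ℤM.· ℤM.E ℤM.⊕ (m ℤM.· A ℤM.⊕ n ℤM.· B) →
  ℚP.eval (Q A B q) (Vec.map toℚ (x Vec.∷ y Vec.∷ z Vec.∷ m Vec.∷ n Vec.∷ Vec.[])) ≡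
  toℚ (ℤT.det (ℤT.krylov (x ∷ y ∷ z ∷ []) N))
eval-Q A B q c x y z m n N N≋ = begin
  ℚP.eval (Q A B q) w
    ≡⟨ eval-ℚP (Q A B q) w ⟩
  ℚT.eval (Q A B q) w
    ≡⟨ ≡.cong (λ p → ℚT.eval p w) (Q-factors A B q) ⟩
  ℚT.eval (binary ⊠ ternary) w
    ≡⟨ ℚT.eval-* binary ternary w ⟩
  ℚT.eval binary w ℚ.* ℚT.eval ternary w
    ≡⟨ ℚT.binary-ternary Aℚ α β (toℚ c ℚ.+ toℚ n ℚ.* γ) (toℚ x) (toℚ y) (toℚ z) (toℚ m) (toℚ n) ⟨
  ℚT.eval (ℚT.ternary Nℚ (ℚT._⊗_ Nℚ Nℚ)) w
    ≡⟨ eval-ternary-square {N} {Nℚ} Nℚ≋ x y z m n ⟩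
  toℚ (ℤT.det (ℤT.krylov (x ∷ y ∷ z ∷ []) N))  ∎
  where
  open ≡.≡-Reasoning
  open QuadraticExpression q
  w = Vec.map toℚ (x Vec.∷ y Vec.∷ z Vec.∷ m Vec.∷ n Vec.∷ Vec.[])
  Aℚ = toMatℚ A
  binary = ℚT.binary (ℚT.trace Aℚ) (ℚT.σ₂ Aℚ) (ℚT.det Aℚ) α β
  ternary = ℚT.ternary Aℚ (ℚT._⊗_ Aℚ Aℚ)
  -- The coordinates of cE + mA + nB on A², A and E once B is replaced by its quadratic expression.
  Nℚ = ℚT.quadratic (toℚ n ℚ.* α) (toℚ m ℚ.+ toℚ n ℚ.* β) (toℚ c ℚ.+ toℚ n ℚ.* γ) Aℚ
  Nℚ≋ : toMatℚ N ℚM.≋ Nℚ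
  Nℚ≋ i j = begin
    toℚ (N i j)
      ≡⟨ ≡.trans (≡.cong toℚ (N≋ i j)) (toℚ-combination c m n ℤM.E A B i j) ⟩
    toℚ c ℚ.* toℚ (ℤM.E i j) ℚ.+ (toℚ m ℚ.* Aℚ i j ℚ.+ toℚ n ℚ.* toℚ (B i j))
      ≡⟨ ≡.cong₂ (λ e b → toℚ c ℚ.* e ℚ.+ (toℚ m ℚ.* Aℚ i j ℚ.+ toℚ n ℚ.* b)) (toℚ-E i j) (equation i j) ⟩
    toℚ c ℚ.* ℚM.E i j ℚ.+ (toℚ m ℚ.* Aℚ i j ℚ.+ toℚ n ℚ.* ℚT.quadratic α β γ Aℚ i j)
      ≡⟨ prove (toℚ c Vec.∷ toℚ m Vec.∷ toℚ n Vec.∷ α Vec.∷ β Vec.∷ γ Vec.∷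
                ℚT._⊗_ Aℚ Aℚ i j Vec.∷ Aℚ i j Vec.∷ ℚM.E i j Vec.∷ Vec.[])
           (at 0 :* at 8 :+ (at 1 :* at 7 :+ at 2 :* (at 3 :* at 6 :+ at 4 :* at 7 :+ at 5 :* at 8)))
           (at 2 :* at 3 :* at 6 :+ (at 1 :+ at 2 :* at 4) :* at 7 :+ (at 0 :+ at 2 :* at 5) :* at 8) ≡.refl ⟩
    Nℚ i j  ∎
    where open ℚT using (prove; at; _:+_; _:*_)

-- From a unit determinant to Frobenius type.

unit-cases : ∀ {d} → ∣ toℚ d ∣ ≡ 1ℚ → d ≡ + 1 ⊎ d ≡ -[1+ 0 ]
unit-cases {d} ∣d∣≡1 with ℚ.∣p∣≡p∨∣p∣≡-p (toℚ d)
... | inj₁ ∣d∣≡d  = inj₁ (toℚ-injective (≡.trans (≡.sym ∣d∣≡d) ∣d∣≡1))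
... | inj₂ ∣d∣≡-d = inj₂ (≡.trans (≡.sym (ℤ.neg-involutive d))
  (≡.cong ℤ.-_ (toℚ-injective {ℤ.- d} {+ 1} (≡.trans (toℚ-neg d) (≡.trans (≡.sym ∣d∣≡-d) ∣d∣≡1)))))

krylov-frobenius : ∀ {C N} → ℤM.Commutes N C → ∀ v →
  let d = ℤT.det (ℤT.krylov v N) in d ≡ + 1 ⊎ d ≡ -[1+ 0 ] → FrobeniusType C
krylov-frobenius {C} {N} NC v unit = trace N , ℤ.- σ₂ N , det N ,
  record { matrix = X ; inverse = adjugate X ; inverseˡ = YX ; inverseʳ = XY ; det≈1 = detX≡1 } ,
  conjugate-commutes {X} {adjugate X} {M} {N} {C} XY XN NC YX
  where
  open ℤT
  K = krylov v N
  d = det K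
  -- Scaling by d multiplies the determinant by d³, so det X = d⁴ = 1 for either sign of d.
  X = d · K
  M = frobenius (trace N) (ℤ.- σ₂ N) (det N)
  detX≡1 : det X ≡ + 1
  detX≡1 = ≡.trans (det-· d K) (fourth-power unit)
    where
    fourth-power : ∀ {d} → d ≡ + 1 ⊎ d ≡ -[1+ 0 ] → d ℤ.* d ℤ.* d ℤ.* d ≡ + 1
    fourth-power (inj₁ ≡.refl) = ≡.refl
    fourth-power (inj₂ ≡.refl) = ≡.refl
  XY : X ⊗ adjugate X ≋ E
  XY i j = ≡.trans (⊗-adjugate X i j) (≡.trans (≡.cong (ℤ._* E i j) detX≡1) (ℤ.*-identityˡ (E i j)))
  YX : adjugate X ⊗ X ≋ E
  YX i j = ≡.trans (adjugate-⊗ X i j) (≡.trans (≡.cong (ℤ._* E i j) detX≡1) (ℤ.*-identityˡ (E i j)))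
  XN : X ⊗ N ≋ M ⊗ X
  XN i j = ≡.trans (·-⊗ d K N i j) (≡.trans (≡.cong (d ℤ.*_) (krylov-⊗ v N i j)) (≡.sym (⊗-· d M K i j)))

-- The basis E, A, B and the two directions of the equivalence.

module Basis (C A B : Matℤ) (irreducible : M⟨3,ℤ⟩ C)
             (basis : ℤM.IsBasis (Ξ̄ C) (ℤM.E ∷ A ∷ B ∷ [])) where
  open ℤM using (_⊗_; _⊕_; _·_; E; O; _≋_; Commutes)
  open ℤM.IsBasis basis

  commutes-A : Commutes A C
  commutes-A = member 1F

  commutes-B : Commutes B C
  commutes-B = member 2F

  combination≡ : ∀ c i j → ℤM.combination c (E ∷ A ∷ B ∷ []) i j ≡ (c 0F · E ⊕ (c 1F · A ⊕ c 2F · B)) i j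
  combination≡ c i j = prove
    (c 0F Vec.∷ c 1F Vec.∷ c 2F Vec.∷ E i j Vec.∷ A i j Vec.∷ B i j Vec.∷ Vec.[])
    (at 0 :* at 3 :+ (at 1 :* at 4 :+ (at 2 :* at 5 :+ con (+ 0))))
    (at 0 :* at 3 :+ (at 1 :* at 4 :+ at 2 :* at 5)) ≡.refl
    where open ℤT using (prove; at; con; _:+_; _:*_; :-_)

  A-nonscalar : ∀ x y → (∀ i j → x ℤ.* E i j ℤ.+ y ℤ.* A i j ≡ + 0) → y ≡ + 0
  A-nonscalar x y xE+yA≡0 = independent c (λ i j → ≡.trans (combination≡ c i j)
    (≡.trans (≡.cong (λ z → x ℤ.* E i j ℤ.+ z) (ℤ.+-identityʳ (y ℤ.* A i j))) (xE+yA≡0 i j))) 1F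
    where
    c : Vector ℤ 3
    c = x ∷ y ∷ + 0 ∷ []

  A-nonquadratic : ∀ {c₀ c₁} → A ⊗ A ≋ c₀ · E ⊕ c₁ · A → ⊥
  A-nonquadratic {c₀} {c₁} A² =
    -- Equality of integers is decidable, so a nonzero S has an explicit nonzero entry.
    let i , row≢0 = Fin.¬∀⟶∃¬ 3 (λ i → ∀ j → S i j ≡ + 0) (λ i → Fin.all? λ j → S i j ℤ.≟ + 0) S≢O
        j , Sij≢0 = Fin.¬∀⟶∃¬ 3 (λ j → S i j ≡ + 0) (λ j → S i j ℤ.≟ + 0) row≢0
    in eigenvalue i j Sij≢0
    where
    open ℤT using (trace; σ₂; det; adjugate; shift)
    ρ = trace A ℤ.+ ℤ.- c₁
    S = shift ρ A
    k = c₀ ℤ.+ (ρ ℤ.* ρ ℤ.+ ℤ.- (ρ ℤ.* trace A) ℤ.+ σ₂ A)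
    adjS≋k : adjugate S ≋ k · E
    adjS≋k = ℤT.adjugate-shift-scalar {A} {c₀} {c₁} A²
    k≡0 : k ≡ + 0
    -- With S = A - ρE, the relation kS = det(S) E becomes -(kρ + det S) E + kA = 0, and
    -- independence gives k = 0.
    k≡0 = A-nonscalar (ℤ.- (k ℤ.* ρ) ℤ.+ ℤ.- det S) k λ i j → ≡.trans
      (prove (k Vec.∷ ρ Vec.∷ det S Vec.∷ A i j Vec.∷ E i j Vec.∷ Vec.[])
        ((:- (at 0 :* at 1) :+ :- at 2) :* at 4 :+ at 0 :* at 3)
        (at 0 :* (at 3 :+ :- at 1 :* at 4) :+ :- (at 2 :* at 4)) ≡.refl)
      (≡.trans (≡.cong (ℤ._+ (ℤ.- (det S ℤ.* E i j))) (ℤT.scalar-adjugate {S} {k} adjS≋k i j))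
        (ℤ.+-inverseʳ (det S ℤ.* E i j)))
      where open ℤT using (prove; at; con; _:+_; _:*_; :-_)
    adjS≋O : adjugate S ≋ O
    adjS≋O i j = ≡.trans (adjS≋k i j) (≡.cong (ℤ._* E i j) k≡0)
    S≢O : ¬ (∀ i j → S i j ≡ + 0)
    -- If S were zero, A = ρE would be a relation in which A has coefficient 1.
    S≢O S≡O = contradiction (A-nonscalar (ℤ.- ρ) (+ 1) λ i j → ≡.trans
      (≡.trans (ℤ.+-comm (ℤ.- ρ ℤ.* E i j) (+ 1 ℤ.* A i j)) (≡.cong (ℤ._+ ℤ.- ρ ℤ.* E i j) (ℤ.*-identityˡ (A i j)))) (S≡O i j)) λ ()
    commutes-S : Commutes S C
    commutes-S = ℤT.commutes-⊕ {A = A} {(ℤ.- ρ) · E} {C} commutes-A (ℤT.commutes-· (ℤ.- ρ) {E} {C} (ℤT.commutes-E C))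

    eigenvalue : ∀ i j → S i j ≢ + 0 → ⊥
    eigenvalue i j Sij≢0 = ℚT.eigenvalue-reducible (λ ()) {r} {toMatℚ C} root irreducible
      where
      κ = toℚ (S i j)
      μ = toℚ ((S ⊗ C) i j)
      instance
        κ-nonZero : ℚ.NonZero κ
        κ-nonZero = ℚ.≢-nonZero λ κ≡0 → Sij≢0 (toℚ-injective κ≡0)
      -- Column j of S is an eigenvector of C; the eigenvalue comes from dividing
      -- `rank-one-eigenvector` by the nonzero entry S i j.
      r = ℚ.1/ κ ℚ.* μ
      cancel : ∀ x → ℚ.1/ κ ℚ.* (κ ℚ.* x) ≡ x
      cancel x = ≡.trans (≡.sym (ℚ.*-assoc (ℚ.1/ κ) κ x))
        (≡.trans (≡.cong (ℚ._* x) (ℚ.*-inverseˡ κ)) (ℚ.*-identityˡ x))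
      u : Vector ℚ 3
      u l = toℚ (S l j)
      eig : ∀ l → ℚT._⊗_ (toMatℚ C) (toMatℚ S) l j ≡ r ℚ.* u l
      eig l = begin
        ℚT._⊗_ (toMatℚ C) (toMatℚ S) l j           ≡⟨ toℚ-⊗ C S l j ⟨
        toℚ ((C ⊗ S) l j)                          ≡⟨ cancel _ ⟨
        ℚ.1/ κ ℚ.* (κ ℚ.* toℚ ((C ⊗ S) l j))       ≡⟨ ≡.cong (ℚ.1/ κ ℚ.*_) (toℚ-* (S i j) ((C ⊗ S) l j)) ⟨
        ℚ.1/ κ ℚ.* toℚ (S i j ℤ.* (C ⊗ S) l j)     ≡⟨ ≡.cong (λ z → ℚ.1/ κ ℚ.* toℚ z) (ℤT.rank-one-eigenvector {S} {C} adjS≋O commutes-S i j l) ⟩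
        ℚ.1/ κ ℚ.* toℚ ((S ⊗ C) i j ℤ.* S l j)     ≡⟨ ≡.cong (ℚ.1/ κ ℚ.*_) (toℚ-* ((S ⊗ C) i j) (S l j)) ⟩
        ℚ.1/ κ ℚ.* (μ ℚ.* u l)                     ≡⟨ ℚ.*-assoc (ℚ.1/ κ) μ (u l) ⟨
        r ℚ.* u l                                  ∎
        where open ≡.≡-Reasoning
      δ = ℚT.det (ℚT.shift r (toMatℚ C))
      root : δ ≡ ℚ.0ℚ
      -- The i-th entry of the eigenvector is κ, so det (C - rE) κ = 0, and κ cancels.
      root = ≡.trans (≡.sym (cancel δ)) (≡.trans (≡.cong (ℚ.1/ κ ℚ.*_) (≡.trans (ℚ.*-comm κ δ)
        (ℚT.eigenvalue-root {toMatℚ C} {u} {r} eig i))) (ℚ.*-zeroʳ (ℚ.1/ κ)))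

  quadraticExpression : QuadraticExpression A B
  quadraticExpression = expression (spanning (A ⊗ A) (ℤT.commutes-⊗ {A} {A} {C} commutes-A commutes-A))
    where
    expression : (∃[ c ] A ⊗ A ≋ ℤM.combination c (E ∷ A ∷ B ∷ [])) → QuadraticExpression A B
    expression (c , A²) with c 2F ℤ.≟ + 0
    ... | yes c₂≡0 = ⊥-elim (A-nonquadratic {c 0F} {c 1F} λ i j → ≡.trans (A² i j) (≡.trans (combination≡ c i j)
                       (≡.cong (λ z → c 0F ℤ.* E i j ℤ.+ z) (≡.trans
                         (≡.cong (λ z → c 1F ℤ.* A i j ℤ.+ z ℤ.* B i j) c₂≡0) (ℤ.+-identityʳ (c 1F ℤ.* A i j))))))
    ... | no c₂≢0 = record { α = r ; β = ℚ.- (r ℚ.* c₁) ; γ = ℚ.- (r ℚ.* c₀) ; equation = equation }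
      where
      c₀ = toℚ (c 0F)
      c₁ = toℚ (c 1F)
      c₂ = toℚ (c 2F)
      instance
        c₂-nonZero : ℚ.NonZero c₂
        c₂-nonZero = ℚ.≢-nonZero λ c₂≡0 → c₂≢0 (toℚ-injective c₂≡0)
      r = ℚ.1/ c₂
      Aℚ = toMatℚ A
      A²ℚ : ∀ i j → ℚT._⊗_ Aℚ Aℚ i j ≡ c₀ ℚ.* ℚM.E i j ℚ.+ (c₁ ℚ.* Aℚ i j ℚ.+ c₂ ℚ.* toℚ (B i j))
      A²ℚ i j = ≡.trans (≡.sym (toℚ-⊗ A A i j)) (≡.trans (≡.cong toℚ (≡.trans (A² i j) (combination≡ c i j)))
        (≡.trans (toℚ-combination (c 0F) (c 1F) (c 2F) E A B i j)
          (≡.cong (λ e → c₀ ℚ.* e ℚ.+ (c₁ ℚ.* Aℚ i j ℚ.+ c₂ ℚ.* toℚ (B i j))) (toℚ-E i j))))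
      equation : toMatℚ B ℚM.≋ ℚT.quadratic r (ℚ.- (r ℚ.* c₁)) (ℚ.- (r ℚ.* c₀)) Aℚ
      equation i j = ≡.sym (begin
        r ℚ.* ℚT._⊗_ Aℚ Aℚ i j ℚ.+ (ℚ.- (r ℚ.* c₁)) ℚ.* Aℚ i j ℚ.+ (ℚ.- (r ℚ.* c₀)) ℚ.* ℚM.E i j
          ≡⟨ ≡.cong (λ z → r ℚ.* z ℚ.+ (ℚ.- (r ℚ.* c₁)) ℚ.* Aℚ i j ℚ.+ (ℚ.- (r ℚ.* c₀)) ℚ.* ℚM.E i j) (A²ℚ i j) ⟩
        r ℚ.* (c₀ ℚ.* ℚM.E i j ℚ.+ (c₁ ℚ.* Aℚ i j ℚ.+ c₂ ℚ.* toℚ (B i j)))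
          ℚ.+ (ℚ.- (r ℚ.* c₁)) ℚ.* Aℚ i j ℚ.+ (ℚ.- (r ℚ.* c₀)) ℚ.* ℚM.E i j
          ≡⟨ prove (r Vec.∷ c₀ Vec.∷ c₁ Vec.∷ c₂ Vec.∷ ℚM.E i j Vec.∷ Aℚ i j Vec.∷ toℚ (B i j) Vec.∷ Vec.[])
               (at 0 :* (at 1 :* at 4 :+ (at 2 :* at 5 :+ at 3 :* at 6))
                 :+ :- (at 0 :* at 2) :* at 5 :+ :- (at 0 :* at 1) :* at 4)
               (at 0 :* at 3 :* at 6) ≡.refl ⟩
        r ℚ.* c₂ ℚ.* toℚ (B i j)   ≡⟨ ≡.cong (ℚ._* toℚ (B i j)) (ℚ.*-inverseˡ c₂) ⟩
        1ℚ ℚ.* toℚ (B i j)         ≡⟨ ℚ.*-identityˡ (toℚ (B i j)) ⟩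
        toℚ (B i j)                ∎)
        where
        open ≡.≡-Reasoning
        open ℚT using (prove; at; _:+_; _:*_; :-_)

  frobenius→solution : ∀ q → FrobeniusType C → ∃[ x ] ∃[ y ] ∃[ z ] ∃[ m ] ∃[ n ]
    ∣ ℚP.eval (Q A B q) (Vec.map toℚ (x Vec.∷ y Vec.∷ z Vec.∷ m Vec.∷ n Vec.∷ Vec.[])) ∣ ≡ 1ℚ
  frobenius→solution q (a₁ , a₂ , a₃ , X , commutes) =
    x , y , z , c 1F , c 2F ,
    ≡.cong ∣_∣ (≡.trans (eval-Q A B q (c 0F) x y z (c 1F) (c 2F) N (λ i j → ≡.trans (N≋ i j) (combination≡ c i j)))
      (≡.cong toℚ det-krylov))
    where
    open ℤM.SL X
    M = frobenius a₁ a₂ a₃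
    -- N = X⁻¹MX commutes with C. Its coordinates on A and B supply m and n, and the first row of X
    -- supplies x, y, z.
    N = inverse ⊗ M ⊗ matrix
    spanned = spanning N (ℤT.commutes-conjugate {matrix} {inverse} {M} {C} inverseˡ commutes)
    c = proj₁ spanned
    N≋ = proj₂ spanned
    x = matrix 0F 0F
    y = matrix 0F 1F
    z = matrix 0F 2F
    v = x ∷ y ∷ z ∷ []
    row₀ : ∀ j → matrix 0F j ≡ v j
    row₀ = λ where
      0F → ≡.refl
      1F → ≡.refl
      2F → ≡.refl
    rows : matrix ≋ ℤT.krylov v N
    rows i j = ≡.trans
      (ℤT.companion-rows {a₁} {a₂} {a₃} {matrix} {N} (ℤT.conjugate-intertwines {matrix} {inverse} M inverseʳ) i j)
      (ℤT.krylov-cong {matrix 0F} {v} N row₀ i j)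
    det-krylov : ℤT.det (ℤT.krylov v N) ≡ + 1
    det-krylov = ≡.trans (≡.sym (ℤT.det-cong {A = matrix} {ℤT.krylov v N} rows)) det≈1

  solution→frobenius : ∀ q → (∃[ x ] ∃[ y ] ∃[ z ] ∃[ m ] ∃[ n ]
    ∣ ℚP.eval (Q A B q) (Vec.map toℚ (x Vec.∷ y Vec.∷ z Vec.∷ m Vec.∷ n Vec.∷ Vec.[])) ∣ ≡ 1ℚ) → FrobeniusType C
  solution→frobenius q (x , y , z , m , n , ∣Q∣≡1) = krylov-frobenius {C} {N} commutes-N (x ∷ y ∷ z ∷ [])
    (unit-cases (≡.trans (≡.cong ∣_∣ (≡.sym (eval-Q A B q (+ 0) x y z m n N (λ _ _ → ≡.refl)))) ∣Q∣≡1))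
    where
    -- The scalar part does not affect the value of Q, so it is taken to be zero.
    N = (+ 0) · E ⊕ (m · A ⊕ n · B)
    commutes-N : Commutes N C
    commutes-N = ℤT.commutes-⊕ {A = (+ 0) · E} {m · A ⊕ n · B} {C} (ℤT.commutes-· (+ 0) {E} {C} (ℤT.commutes-E C))
      (ℤT.commutes-⊕ {A = m · A} {n · B} {C} (ℤT.commutes-· m {A} {C} commutes-A) (ℤT.commutes-· n {B} {C} commutes-B))

theorem3 : (C : Matℤ) → M⟨3,ℤ⟩ C →
    (A B : Matℤ) → ℤM.IsBasis (Ξ̄ C) (ℤM.E ∷ A ∷ B ∷ []) →
    QuadraticExpression A B ×
    ((q : QuadraticExpression A B) →
    HasIntegerCoefficients (Q A B q) ×
    (FrobeniusType C ⇔
    (∃[ x ] ∃[ y ] ∃[ z ] ∃[ m ] ∃[ n ]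
    ∣ ℚP.eval (Q A B q) (Vec.map toℚ (x Vec.∷ y Vec.∷ z Vec.∷ m Vec.∷ n Vec.∷ Vec.[])) ∣ ≡ 1ℚ)))
theorem3 C irreducible A B basis =
  quadraticExpression , λ q → Q-integral A B q , mk⇔ (frobenius→solution q) (solution→frobenius q)
  where open Basis C A B irreducible basis
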